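{- Let $\nu\geq 2$ be an integer, let $P\in\mathbb{C}[x]$ with $\deg P=n>1$, and let $Q\in\mathbb{C}[x_1,\dotsc,x_\nu]$ with $\deg Q\geq 1$. Suppose that $$P\big(Q(x_1,\dotsc,x_\nu)\big)=Q\big(P(x_1),\dotsc,P(x_\nu)\big)$$ and that $Q\notin\mathbb{C}[x_i]$ for every $i\in\{1,\dotsc,\nu\}$ (that is, $Q$ is not a polynomial in a single one of the variables). Then there exist an affine bijection $\lambda\in\mathbf{Aff}$, a constant $c\in\mathbb{C}$ and a nonzero multi-index $\alpha\in\mathbb{Z}_{\geq 0}^\nu$ such that $$C_\lambda(P)(x)=x^n,\qquad C_\lambda(Q)(x_1,\dotsc,x_\nu)=c\,x^\alpha,\qquad c^{n-1}=1.$$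
   Context: $\mathbf{Aff}$ denotes the group of affine bijections $\mathbb{C}\to\mathbb{C}$, $z\mapsto az+b$, with $a,b\in\mathbb{C}$, $a\neq 0$. For $\lambda\in\mathbf{Aff}$ and a polynomial $R\in\mathbb{C}[z_1,\dotsc,z_k]$ (any $k\geq 1$), the conjugate polynomial is $C_\lambda(R)(z_1,\dotsc,z_k)=\lambda\big(R(\lambda^{ -1}(z_1),\dotsc,\lambda^{ -1}(z_k))\big)$. For a multi-index $\alpha=(\alpha_1,\dotsc,\alpha_\nu)\in\mathbb{Z}_{\geq 0}^\nu$, $x^\alpha:=x_1^{\alpha_1}\cdots x_\nu^{\alpha_\nu}$. -}

module Defs where

open import Algebra.Bundles using (CommutativeRing; RawSemiring; Semiring)
open import Algebra.Core using (Op₁; Op₂)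
import Algebra.Definitions as AlgebraDefinitions
import Algebra.Definitions.RawSemiring as RawSemiringDefinitions
import Algebra.Properties.Ring as RingProperties
import Algebra.Solver.Ring.NaturalCoefficients.Default as NaturalCoefficients
open import Algebra.Structures using (IsCommutativeRing)
open import Data.Bool.Base using (if_then_else_)
open import Data.Fin.Base using (Fin; zero; suc)
open import Data.List.Base using (List; []; _∷_; _++_; [_]; cartesianProductWith)
open import Data.Nat.Base as ℕ using (ℕ)
import Data.Nat.Properties as ℕₚ
open import Data.Product.Base using (∃; _×_; _,_; proj₁; proj₂)
open import Data.Vec.Base as Vec using (Vec; []; _∷_; replicate; zipWith; _[_]≔_)
import Data.Vec.Properties as Vecₚ
open import Level using (_⊔_; 0ℓ)
open import Relation.Binary.Core using (Rel)
open import Relation.Binary.Definitions using (tri<; tri≈; tri>)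
open import Relation.Binary.PropositionalEquality.Core using (_≡_)
import Relation.Binary.Reasoning.Setoid as SetoidReasoning
import Relation.Binary.Construct.StrictToNonStrict as ToNonStrict
open import Relation.Binary.Structures using (IsStrictTotalOrder)
open import Relation.Nullary.Decidable.Core using (does; yes; no)
open import Relation.Nullary.Negation.Core using (¬_; contradiction)
open import Relation.Unary using (Pred; _∈_; Satisfiable)

-- The real numbers are described by the classical axioms of a complete
-- ordered field, which determine them up to a unique isomorphism.  The order
-- is trichotomous and all nonempty bounded subsets have suprema, so this is the
-- classical real line: no instance can be expected without excluded middle.

record CompleteOrderedField : Set₁ where
  infix  8 -_
  infixl 7 _*_
  infixl 6 _+_
  infix  4 _≈_ _<_
  field
    Carrier : Set
    _≈_     : Rel Carrier 0ℓ
    _<_     : Rel Carrier 0ℓ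
    _+_     : Op₂ Carrier
    _*_     : Op₂ Carrier
    -_      : Op₁ Carrier
    0#      : Carrier
    1#      : Carrier

  open AlgebraDefinitions _≈_ using (Invertible)
  open ToNonStrict _≈_ _<_ public using (_≤_)

  UpperBound : Pred Carrier 0ℓ → Pred Carrier 0ℓ
  UpperBound S b = ∀ {x} → x ∈ S → x ≤ b

  field
    isCommutativeRing  : IsCommutativeRing _≈_ _+_ _*_ -_ 0# 1#
    0≉1                : ¬ (0# ≈ 1#)
    invertible         : ∀ {x} → ¬ (x ≈ 0#) → Invertible 1# _*_ x
    isStrictTotalOrder : IsStrictTotalOrder _≈_ _<_
    +-monoˡ-<          : ∀ z {x y} → x < y → x + z < y + z
    *-pos              : ∀ {x y} → 0# < x → 0# < y → 0# < x * y
    supremum           : (S : Pred Carrier 0ℓ) →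
                         Satisfiable S → Satisfiable (UpperBound S) →
                         ∃ λ s → s ∈ UpperBound S ×
                                 (∀ {b} → b ∈ UpperBound S → s ≤ b)

  commutativeRing : CommutativeRing 0ℓ 0ℓ
  commutativeRing = record { isCommutativeRing = isCommutativeRing }

private module RingIdentities {c ℓ} (R : CommutativeRing c ℓ) where
  open CommutativeRing R
  open RingProperties ring
  open NaturalCoefficients commutativeSemiring
  open SetoidReasoning setoid

  -- The solver knows no negation; minus is multiplication by m = - 1.
  private
    m = - 1#

    minus : ∀ x y → x - y ≈ x + m * y
    minus x y = +-congˡ (sym (-1*x≈-x y))

  assoc-re : ∀ a b c d e f →
             (a * c - b * d) * e - (a * d + b * c) * f ≈
             a * (c * e - d * f) - b * (c * f + d * e)
  assoc-re a b c d e f = begin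
    (a * c - b * d) * e - (a * d + b * c) * f
      ≈⟨ trans (minus _ _) (+-congʳ (*-congʳ (minus _ _))) ⟩
    (a * c + m * (b * d)) * e + m * ((a * d + b * c) * f)
      ≈⟨ solve 7 (λ a b c d e f m →
           (a :* c :+ m :* (b :* d)) :* e :+ m :* ((a :* d :+ b :* c) :* f) :=
           a :* (c :* e :+ m :* (d :* f)) :+ m :* (b :* (c :* f :+ d :* e)))
           refl a b c d e f m ⟩
    a * (c * e + m * (d * f)) + m * (b * (c * f + d * e))
      ≈⟨ trans (minus _ _) (+-congʳ (*-congˡ (minus _ _))) ⟨
    a * (c * e - d * f) - b * (c * f + d * e) ∎

  assoc-im : ∀ a b c d e f →
             (a * c - b * d) * f + (a * d + b * c) * e ≈
             a * (c * f + d * e) + b * (c * e - d * f)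
  assoc-im a b c d e f = begin
    (a * c - b * d) * f + (a * d + b * c) * e
      ≈⟨ +-congʳ (*-congʳ (minus _ _)) ⟩
    (a * c + m * (b * d)) * f + (a * d + b * c) * e
      ≈⟨ solve 7 (λ a b c d e f m →
           (a :* c :+ m :* (b :* d)) :* f :+ (a :* d :+ b :* c) :* e :=
           a :* (c :* f :+ d :* e) :+ b :* (c :* e :+ m :* (d :* f)))
           refl a b c d e f m ⟩
    a * (c * f + d * e) + b * (c * e + m * (d * f))
      ≈⟨ +-congˡ (*-congˡ (minus _ _)) ⟨
    a * (c * f + d * e) + b * (c * e - d * f) ∎

  distribˡ-re : ∀ a b c d e f →
                a * (c + e) - b * (d + f) ≈ (a * c - b * d) + (a * e - b * f)
  distribˡ-re a b c d e f = begin
    a * (c + e) - b * (d + f)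
      ≈⟨ minus _ _ ⟩
    a * (c + e) + m * (b * (d + f))
      ≈⟨ solve 7 (λ a b c d e f m →
           a :* (c :+ e) :+ m :* (b :* (d :+ f)) :=
           (a :* c :+ m :* (b :* d)) :+ (a :* e :+ m :* (b :* f)))
           refl a b c d e f m ⟩
    (a * c + m * (b * d)) + (a * e + m * (b * f))
      ≈⟨ +-cong (minus _ _) (minus _ _) ⟨
    (a * c - b * d) + (a * e - b * f) ∎

  distribˡ-im : ∀ a b c d e f →
                a * (d + f) + b * (c + e) ≈ (a * d + b * c) + (a * f + b * e)
  distribˡ-im = solve 6 (λ a b c d e f →
    a :* (d :+ f) :+ b :* (c :+ e) :=
    (a :* d :+ b :* c) :+ (a :* f :+ b :* e)) refl

  comm-re : ∀ a b c d → a * c - b * d ≈ c * a - d * b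
  comm-re a b c d = +-cong (*-comm a c) (-‿cong (*-comm b d))

  comm-im : ∀ a b c d → a * d + b * c ≈ c * b + d * a
  comm-im = solve 4 (λ a b c d →
    a :* d :+ b :* c := c :* b :+ d :* a) refl

  identityˡ-re : ∀ a b → 1# * a - 0# * b ≈ a
  identityˡ-re a b = begin
    1# * a - 0# * b  ≈⟨ +-cong (*-identityˡ a) (-‿cong (zeroˡ b)) ⟩
    a - 0#           ≈⟨ +-congˡ -0#≈0# ⟩
    a + 0#           ≈⟨ +-identityʳ a ⟩
    a                ∎

  identityˡ-im : ∀ a b → 1# * b + 0# * a ≈ b
  identityˡ-im a b = trans (+-cong (*-identityˡ b) (zeroˡ a)) (+-identityʳ b)

  square-neg : ∀ x → - x * - x ≈ x * x
  square-neg x = begin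
    - x * - x      ≈⟨ -‿distribˡ-* x (- x) ⟨
    - (x * - x)    ≈⟨ -‿cong (-‿distribʳ-* x x) ⟨
    - (- (x * x))  ≈⟨ -‿involutive (x * x) ⟩
    x * x          ∎

  inverse-re : ∀ a b k → a * (a * k) - b * (- b * k) ≈ (a * a + b * b) * k
  inverse-re a b k = begin
    a * (a * k) - b * (- b * k)    ≈⟨ +-congˡ (-‿distribˡ-* b (- b * k)) ⟩
    a * (a * k) + - b * (- b * k)  ≈⟨ +-cong (*-assoc _ _ _) (*-assoc _ _ _) ⟨
    a * a * k + - b * - b * k      ≈⟨ distribʳ k (a * a) (- b * - b) ⟨
    (a * a + - b * - b) * k        ≈⟨ *-congʳ (+-congˡ (square-neg b)) ⟩
    (a * a + b * b) * k            ∎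

  inverse-im : ∀ a b k → a * (- b * k) + b * (a * k) ≈ 0#
  inverse-im a b k = begin
    a * (- b * k) + b * (a * k)
      ≈⟨ solve 4 (λ a b b′ k →
           a :* (b′ :* k) :+ b :* (a :* k) := (a :* k) :* (b′ :+ b))
           refl a b (- b) k ⟩
    (a * k) * (- b + b)  ≈⟨ *-congˡ (-‿inverseˡ b) ⟩
    (a * k) * 0#         ≈⟨ zeroʳ (a * k) ⟩
    0#                   ∎

module Complex (ℝ : CompleteOrderedField) where
  private
    module ℝ = CompleteOrderedField ℝ
    module R = CommutativeRing ℝ.commutativeRing
    module < = IsStrictTotalOrder ℝ.isStrictTotalOrder

    open RingIdentities ℝ.commutativeRing

  open R using (_≈_; _+_; _*_; -_; _-_; 0#; 1#)
  open ℝ using (_<_)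

  infixl 6 _+i_
  record ℂ : Set where
    constructor _+i_
    field
      re : ℝ.Carrier
      im : ℝ.Carrier
  open ℂ public

  infix 4 _≈ℂ_
  _≈ℂ_ : Rel ℂ 0ℓ
  z ≈ℂ w = re z ≈ re w × im z ≈ im w

  infixl 6 _+ℂ_
  _+ℂ_ : Op₂ ℂ
  (a +i b) +ℂ (c +i d) = (a + c) +i (b + d)

  infixl 7 _*ℂ_
  _*ℂ_ : Op₂ ℂ
  (a +i b) *ℂ (c +i d) = (a * c - b * d) +i (a * d + b * c)

  infix 8 -ℂ_
  -ℂ_ : Op₁ ℂ
  -ℂ (a +i b) = (- a) +i (- b)

  0ℂ 1ℂ : ℂ
  0ℂ = 0# +i 0#
  1ℂ = 1# +i 0#

  private
    *ℂ-identityˡ : ∀ z → 1ℂ *ℂ z ≈ℂ z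
    *ℂ-identityˡ (a +i b) = identityˡ-re a b , identityˡ-im a b

    *ℂ-comm : ∀ z w → z *ℂ w ≈ℂ w *ℂ z
    *ℂ-comm (a +i b) (c +i d) = comm-re a b c d , comm-im a b c d

    *ℂ-distribˡ-+ℂ : ∀ z w v → z *ℂ (w +ℂ v) ≈ℂ (z *ℂ w) +ℂ (z *ℂ v)
    *ℂ-distribˡ-+ℂ (a +i b) (c +i d) (e +i f) =
      distribˡ-re a b c d e f , distribˡ-im a b c d e f

    ≈ℂ-trans : ∀ {z w v} → z ≈ℂ w → w ≈ℂ v → z ≈ℂ v
    ≈ℂ-trans (p , q) (r , s) = R.trans p r , R.trans q s

    +ℂ-cong : ∀ {z w u v} → z ≈ℂ w → u ≈ℂ v → z +ℂ u ≈ℂ w +ℂ v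
    +ℂ-cong (p , q) (r , s) = R.+-cong p r , R.+-cong q s

  ℂ-isCommutativeRing : IsCommutativeRing _≈ℂ_ _+ℂ_ _*ℂ_ -ℂ_ 0ℂ 1ℂ
  ℂ-isCommutativeRing = record
    { isRing = record
      { +-isAbelianGroup = record
        { isGroup = record
          { isMonoid = record
            { isSemigroup = record
              { isMagma = record
                { isEquivalence = record
                  { refl  = R.refl , R.refl
                  ; sym   = λ (p , q) → R.sym p , R.sym q
                  ; trans = ≈ℂ-trans
                  }
                ; ∙-cong = +ℂ-cong
                }
              ; assoc = λ _ _ _ → R.+-assoc _ _ _ , R.+-assoc _ _ _
              }
            ; identity = (λ _ → R.+-identityˡ _ , R.+-identityˡ _)
                       , (λ _ → R.+-identityʳ _ , R.+-identityʳ _)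
            }
          ; inverse = (λ _ → R.-‿inverseˡ _ , R.-‿inverseˡ _)
                    , (λ _ → R.-‿inverseʳ _ , R.-‿inverseʳ _)
          ; ⁻¹-cong = λ (p , q) → R.-‿cong p , R.-‿cong q
          }
        ; comm = λ _ _ → R.+-comm _ _ , R.+-comm _ _
        }
      ; *-cong = λ (p , q) (r , s) →
            R.+-cong (R.*-cong p r) (R.-‿cong (R.*-cong q s))
          , R.+-cong (R.*-cong p s) (R.*-cong q r)
      ; *-assoc = λ (a +i b) (c +i d) (e +i f) →
            assoc-re a b c d e f , assoc-im a b c d e f
      ; *-identity = *ℂ-identityˡ
                   , (λ z → ≈ℂ-trans (*ℂ-comm z 1ℂ) (*ℂ-identityˡ z))
      ; distrib = *ℂ-distribˡ-+ℂ
                , (λ z w v → ≈ℂ-trans (*ℂ-comm (w +ℂ v) z)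
                            (≈ℂ-trans (*ℂ-distribˡ-+ℂ z w v)
                                      (+ℂ-cong (*ℂ-comm z w) (*ℂ-comm z v))))
      }
    ; *-comm = *ℂ-comm
    }

  ℂ-commutativeRing : CommutativeRing 0ℓ 0ℓ
  ℂ-commutativeRing = record { isCommutativeRing = ℂ-isCommutativeRing }

  private
    0<x+y : ∀ {x y} → 0# < x → 0# < y → 0# < x + y
    0<x+y {x} {y} 0<x 0<y =
      <.trans 0<y (<.<-respˡ-≈ (R.+-identityˡ y) (ℝ.+-monoˡ-< y 0<x))

    neg-pos : ∀ {x} → x < 0# → 0# < - x
    neg-pos {x} x<0 = <.<-respˡ-≈ (R.-‿inverseʳ x)
      (<.<-respʳ-≈ (R.+-identityˡ (- x)) (ℝ.+-monoˡ-< (- x) x<0))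

    0<x² : ∀ {x} → ¬ (x ≈ 0#) → 0# < x * x
    0<x² {x} x≉0 with <.compare x 0#
    ... | tri< x<0 _ _ =
      <.<-respʳ-≈ (square-neg x) (ℝ.*-pos (neg-pos x<0) (neg-pos x<0))
    ... | tri≈ _ x≈0 _ = contradiction x≈0 x≉0
    ... | tri> _ _ 0<x = ℝ.*-pos 0<x 0<x

    0<norm² : ∀ z → ¬ (z ≈ℂ 0ℂ) → 0# < re z * re z + im z * im z
    0<norm² (a +i b) z≉0 with a <.≟ 0# | b <.≟ 0#
    ... | yes a≈0 | yes b≈0 = contradiction (a≈0 , b≈0) z≉0
    ... | yes a≈0 | no  b≉0 = <.<-respʳ-≈
      (R.sym (R.trans (R.+-congʳ (R.trans (R.*-congʳ a≈0) (R.zeroˡ a)))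
                      (R.+-identityˡ (b * b))))
      (0<x² b≉0)
    ... | no  a≉0 | yes b≈0 = <.<-respʳ-≈
      (R.sym (R.trans (R.+-congˡ (R.trans (R.*-congʳ b≈0) (R.zeroˡ b)))
                      (R.+-identityʳ (a * a))))
      (0<x² a≉0)
    ... | no  a≉0 | no  b≉0 = 0<x+y (0<x² a≉0) (0<x² b≉0)

    norm²-invertible : ∀ z → ¬ (z ≈ℂ 0ℂ) →
                       AlgebraDefinitions.Invertible _≈_ 1# _*_
                         (re z * re z + im z * im z)
    norm²-invertible z z≉0 =
      ℝ.invertible (λ eq → <.irrefl (R.sym eq) (0<norm² z z≉0))

  inverse : ∀ z → ¬ (z ≈ℂ 0ℂ) → ℂ
  inverse z@(a +i b) z≉0 = (a * k) +i (- b * k)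
    where k = proj₁ (norm²-invertible z z≉0)

  inverseʳ : ∀ z (z≉0 : ¬ (z ≈ℂ 0ℂ)) → z *ℂ inverse z z≉0 ≈ℂ 1ℂ
  inverseʳ z@(a +i b) z≉0 =
    R.trans (inverse-re a b k) (proj₂ (proj₂ (norm²-invertible z z≉0))) ,
    inverse-im a b k
    where k = proj₁ (norm²-invertible z z≉0)

  infixr 8 _^ℂ_
  _^ℂ_ : ℂ → ℕ → ℂ
  _^ℂ_ = RawSemiringDefinitions._^_
    (Semiring.rawSemiring (CommutativeRing.semiring ℂ-commutativeRing))

-- A polynomial in k variables is presented by a list of terms (c , α), read as
-- the formal sum of the c x^α.  The same exponent may occur several times and
-- coefficients may vanish, so that polynomials are compared by _≈ₚ_.

module Polynomials {c ℓ} (R : CommutativeRing c ℓ) where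
  open CommutativeRing R using (Carrier; _≈_; _+_; _*_; 0#; 1#)

  Poly : ℕ → Set c
  Poly k = List (Carrier × Vec ℕ k)

  module _ {k : ℕ} where

    coeff : Poly k → Vec ℕ k → Carrier
    coeff []            α = 0#
    coeff ((a , β) ∷ p) α =
      if does (Vecₚ.≡-dec ℕₚ._≟_ β α) then a + coeff p α else coeff p α

    infix 4 _≈ₚ_
    _≈ₚ_ : Rel (Poly k) ℓ
    p ≈ₚ q = ∀ α → coeff p α ≈ coeff q α

    monomial : Carrier → Vec ℕ k → Poly k
    monomial a α = [ (a , α) ]

    const : Carrier → Poly k
    const a = monomial a (replicate k 0)

    X : Fin k → Poly k
    X i = monomial 1# (replicate k 0 [ i ]≔ 1)

    infixl 6 _+ₚ_
    _+ₚ_ : Op₂ (Poly k)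
    _+ₚ_ = _++_

    infixl 7 _*ₚ_
    _*ₚ_ : Op₂ (Poly k)
    _*ₚ_ = cartesianProductWith λ (a , α) (b , β) → a * b , zipWith ℕ._+_ α β

    rawSemiringₚ : RawSemiring c ℓ
    rawSemiringₚ = record
      { _≈_ = _≈ₚ_ ; _+_ = _+ₚ_ ; _*_ = _*ₚ_ ; 0# = [] ; 1# = const 1# }

    open RawSemiringDefinitions rawSemiringₚ public using () renaming (_^_ to _^ₚ_)

    HasDegree : Poly k → ℕ → Set ℓ
    HasDegree p d =
      (∃ λ α → Vec.sum α ≡ d × ¬ (coeff p α ≈ 0#)) ×
      (∀ α → d ℕ.< Vec.sum α → coeff p α ≈ 0#)

  module _ {l : ℕ} where

    -- power f α is f₁^α₁ ⋯ f_k^α_k, and p ⟦ f ⟧ is p(f₁, …, f_k).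
    power : ∀ {k} → (Fin k → Poly l) → Vec ℕ k → Poly l
    power f []      = const 1#
    power f (a ∷ α) = f zero ^ₚ a *ₚ power (λ i → f (suc i)) α

    infixl 9 _⟦_⟧
    _⟦_⟧ : ∀ {k} → Poly k → (Fin k → Poly l) → Poly l
    []            ⟦ f ⟧ = []
    ((a , α) ∷ p) ⟦ f ⟧ = const a *ₚ power f α +ₚ p ⟦ f ⟧

  infixl 9 _∘ₚ_
  _∘ₚ_ : ∀ {l} → Poly 1 → Poly l → Poly l
  p ∘ₚ q = p ⟦ (λ _ → q) ⟧

  InSingleVariable : ∀ {k} → Poly k → Fin k → Set (c ⊔ ℓ)
  InSingleVariable p i = ∃ λ (q : Poly 1) → p ≈ₚ q ∘ₚ X i

module ComplexPolynomials (ℝ : CompleteOrderedField) where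
  open Complex ℝ public
  open Polynomials ℂ-commutativeRing public

  -- The affine bijection z ↦ slope z + intercept.
  record Aff : Set where
    field
      slope     : ℂ
      intercept : ℂ
      slope≉0   : ¬ (slope ≈ℂ 0ℂ)

    slope⁻¹ : ℂ
    slope⁻¹ = inverse slope slope≉0

    -- Postcomposition of a polynomial map with the bijection and its inverse.
    apply : ∀ {k} → Poly k → Poly k
    apply p = const slope *ₚ p +ₚ const intercept

    apply⁻¹ : ∀ {k} → Poly k → Poly k
    apply⁻¹ p = const slope⁻¹ *ₚ (p +ₚ const (-ℂ intercept))

  conjugate : ∀ {k} → Aff → Poly k → Poly k
  conjugate λ′ p = apply (p ⟦ (λ i → apply⁻¹ (X i)) ⟧)
    where open Aff λ′

{-# OPTIONS --safe #-}

-- Conjugation by an affine map makes P monic without a term of degree n - 1, so P(w) = wⁿ + ρ(w) with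
-- deg ρ ≤ n - 2.  Let Q = A xᵢᵖ + … as a polynomial in a variable xᵢ on which it depends; then A(P(x)) = A(x)ⁿ.
-- For points x, y with A(x) A(y) ≠ 0, put D(t) = A(y) Q(x[i≔t]) - A(x) Q(y[i≔t]).  A term of degree r < p in D
-- contributes to the functional equation in degree (n - 1) p + r on the P∘Q side, where ρ is invisible, but only
-- in degree n r on the Q∘P side; hence D = 0 and Q = A · g(xᵢ).  If Q also depends on some other xⱼ, then A is
-- not constant and P(A g(xᵢ)) = Aⁿ g(P(xᵢ)) forces ρ = 0.  With P = wⁿ, the same comparison applied to
-- Q - A xᵢᵖ shows that g is a monomial; this holds for every variable, so Q is a monomial.
--
-- Equality in ℂ is decidable, so all the equations may be proved by contradiction.  The affine map needs a root
-- of the leading coefficient of P, which comes from the intermediate value theorem.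

module Submission where

open import Defs
open import Algebra.Bundles using (CommutativeRing; Semiring)
import Algebra.Definitions.RawSemiring
import Algebra.Properties.AbelianGroup
import Algebra.Properties.CommutativeSemiring.Exp
import Algebra.Properties.Group
import Algebra.Properties.Ring
import Algebra.Properties.Semiring.Exp
import Algebra.Properties.Semiring.Mult
import Algebra.Properties.Semiring.Mult.TCOptimised
import Algebra.Solver.Ring
open import Algebra.Solver.Ring.AlmostCommutativeRing using (fromCommutativeRing; _-Raw-AlmostCommutative⟶_)
open import Data.Bool.Base using (if_then_else_)
open import Data.Empty using (⊥)
open import Data.Fin.Base using (Fin; zero; suc)
import Data.Fin.Properties as Finₚ
open import Data.Integer.Base as ℤ using (ℤ; +_; -[1+_])
import Data.Integer.Properties as ℤₚ
open import Data.List.Base as List using ([]; _∷_; _++_; length)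
open import Data.List.Relation.Unary.All as All using (All; []; _∷_)
open import Data.List.Relation.Unary.Any as Any using (Any; here; there; any?)
open import Data.Maybe.Base using (Maybe; just; nothing)
open import Data.Nat.Base as ℕ using (ℕ; zero; suc; z≤n; s≤s)
open import Data.Nat.Induction using (<-rec)
import Data.Nat.Properties as ℕₚ
open import Data.Product.Base using (Σ; ∃; ∃₂; _×_; _,_; proj₁; proj₂)
open import Data.Sum.Base using (_⊎_; inj₁; inj₂)
open import Data.Vec.Base as Vec using (Vec; []; _∷_; lookup; replicate; zipWith; _[_]≔_)
import Data.Vec.Properties as Vecₚ
open import Function.Base using (_∘_; _⟨_⟩_)
open import Level using (0ℓ)
open import Relation.Binary.Definitions using (Decidable; tri<; tri≈; tri>)
open import Relation.Binary.PropositionalEquality.Core as ≡ using (_≡_; _≢_)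
import Relation.Binary.Reasoning.Setoid
open import Relation.Binary.Structures using (IsStrictTotalOrder)
open import Relation.Nullary.Decidable.Core using (Dec; yes; no; does; ¬?; _×-dec_; decidable-stable)
open import Relation.Nullary.Negation.Core using (¬_; contradiction)

-- Why the term of degree n - 1 must go: it would contribute to the functional equation in degree (n
-- - 1) p, exactly where the case r = 0 is tested. The coefficient found in degree (n - 1) p + r is
-- n (A(x) A(y))ⁿ⁻¹ times that of D, so characteristic zero is used to cancel n. The relation
-- A(P(x)) = A(x)ⁿ keeps the points with A ≠ 0 stable under P; this matters because the equation
-- relates D at (x, y) to D at (P(x), P(y)), so the bound on deg D is lowered for all such pairs at
-- once. Lists of terms have no normal form and A is only a function of a point. Identities are
-- therefore proved between functions, and comparison of coefficients becomes uniqueness of leading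
-- terms, obtained from dilation by 2. All this takes place over an abstract field; only the root is
-- specific to ℂ. The root is found without polar coordinates. On a path from a solution of ζⁿ = -1
-- to 1 the power wⁿ runs from -1 to 1, hence meets the real line through z; a real root then
-- corrects the real factor.

-- A ring solver with integer coefficients, able to handle subtraction.

module IntegerCoefficients {c ℓ} (R : CommutativeRing c ℓ) where
  open CommutativeRing R
  open Algebra.Properties.Ring ring
  open Algebra.Properties.AbelianGroup +-abelianGroup using (⁻¹-∙-comm)
  open Algebra.Properties.Semiring.Mult.TCOptimised semiring using (×-homo-+; ×1-homo-*; 1+×) renaming (_×_ to _×ᴿ_)
  open Relation.Binary.Reasoning.Setoid setoid

  -- The multiple `_×ᴿ_` is the variant for which `1 ×ᴿ 1#` reduces to `1#`, so `con (+ 1)` in a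
  -- solver equation is `1#` itself.
  ⟦_⟧ℤ : ℤ → Carrier
  ⟦ + n ⟧ℤ      = n ×ᴿ 1#
  ⟦ -[1+ n ] ⟧ℤ = - (suc n ×ᴿ 1#)

  ⟦⟧ℤ-neg : ∀ i → ⟦ ℤ.- i ⟧ℤ ≈ - ⟦ i ⟧ℤ
  ⟦⟧ℤ-neg (+ zero)    = sym -0#≈0#
  ⟦⟧ℤ-neg (+ (suc n)) = refl
  ⟦⟧ℤ-neg -[1+ n ]    = sym (-‿involutive _)

  ⟦⟧ℤ-⊖ : ∀ m n → ⟦ m ℤ.⊖ n ⟧ℤ ≈ m ×ᴿ 1# - n ×ᴿ 1#
  ⟦⟧ℤ-⊖ zero    zero    = sym (-‿inverseʳ 0#)
  ⟦⟧ℤ-⊖ zero    (suc n) = sym (+-identityˡ _)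
  ⟦⟧ℤ-⊖ (suc m) zero    = sym (trans (+-congˡ -0#≈0#) (+-identityʳ _))
  ⟦⟧ℤ-⊖ (suc m) (suc n) = begin
    ⟦ suc m ℤ.⊖ suc n ⟧ℤ                   ≡⟨ ≡.cong ⟦_⟧ℤ (ℤₚ.[1+m]⊖[1+n]≡m⊖n m n) ⟩
    ⟦ m ℤ.⊖ n ⟧ℤ                           ≈⟨ ⟦⟧ℤ-⊖ m n ⟩
    m ×ᴿ 1# - n ×ᴿ 1#                        ≈⟨ +-congʳ (+-identityˡ _) ⟨
    (0# + m ×ᴿ 1#) - n ×ᴿ 1#                 ≈⟨ +-congʳ (+-congʳ (-‿inverseʳ 1#)) ⟨
    ((1# - 1#) + m ×ᴿ 1#) - n ×ᴿ 1#          ≈⟨ +-congʳ (+-assoc _ _ _) ⟩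
    (1# + (- 1# + m ×ᴿ 1#)) - n ×ᴿ 1#        ≈⟨ +-congʳ (+-congˡ (+-comm _ _)) ⟩
    (1# + (m ×ᴿ 1# - 1#)) - n ×ᴿ 1#          ≈⟨ +-congʳ (+-assoc _ _ _) ⟨
    ((1# + m ×ᴿ 1#) - 1#) - n ×ᴿ 1#          ≈⟨ +-assoc _ _ _ ⟩
    (1# + m ×ᴿ 1#) + (- 1# - n ×ᴿ 1#)        ≈⟨ +-cong (sym (1+× m 1#)) (trans (⁻¹-∙-comm _ _) (-‿cong (sym (1+× n 1#)))) ⟩
    suc m ×ᴿ 1# - suc n ×ᴿ 1#                ∎

  ⟦⟧ℤ-+ : ∀ i j → ⟦ i ℤ.+ j ⟧ℤ ≈ ⟦ i ⟧ℤ + ⟦ j ⟧ℤ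
  ⟦⟧ℤ-+ (+ m)    (+ n)    = ×-homo-+ 1# m n
  ⟦⟧ℤ-+ (+ m)    -[1+ n ] = ⟦⟧ℤ-⊖ m (suc n)
  ⟦⟧ℤ-+ -[1+ m ] (+ n)    = trans (⟦⟧ℤ-⊖ n (suc m)) (+-comm _ _)
  ⟦⟧ℤ-+ -[1+ m ] -[1+ n ] = begin
    - (suc (suc (m ℕ.+ n)) ×ᴿ 1#)     ≈⟨ -‿cong (1+× (suc (m ℕ.+ n)) 1#) ⟩
    - (1# + (suc m ℕ.+ n) ×ᴿ 1#)      ≈⟨ -‿cong (+-congˡ (×-homo-+ 1# (suc m) n)) ⟩
    - (1# + (suc m ×ᴿ 1# + n ×ᴿ 1#))   ≈⟨ -‿cong (trans (sym (+-assoc _ _ _)) (trans (+-congʳ (+-comm _ _)) (+-assoc _ _ _))) ⟩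
    - (suc m ×ᴿ 1# + (1# + n ×ᴿ 1#))   ≈⟨ -‿cong (+-congˡ (1+× n 1#)) ⟨
    - (suc m ×ᴿ 1# + suc n ×ᴿ 1#)      ≈⟨ ⁻¹-∙-comm _ _ ⟨
    - (suc m ×ᴿ 1#) - (suc n ×ᴿ 1#)    ∎

  ⟦⟧ℤ-* : ∀ i j → ⟦ i ℤ.* j ⟧ℤ ≈ ⟦ i ⟧ℤ * ⟦ j ⟧ℤ
  ⟦⟧ℤ-* (+ m) (+ n) = begin
    ⟦ + m ℤ.* + n ⟧ℤ  ≡⟨ ≡.cong ⟦_⟧ℤ (ℤₚ.+◃n≡+n (m ℕ.* n)) ⟩
    (m ℕ.* n) ×ᴿ 1#    ≈⟨ ×1-homo-* m n ⟩
    m ×ᴿ 1# * n ×ᴿ 1#   ∎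
  ⟦⟧ℤ-* (+ m) -[1+ n ] = begin
    ⟦ + m ℤ.* -[1+ n ] ⟧ℤ      ≡⟨ ≡.cong ⟦_⟧ℤ (ℤₚ.-◃n≡-n (m ℕ.* suc n)) ⟩
    ⟦ ℤ.- + (m ℕ.* suc n) ⟧ℤ   ≈⟨ ⟦⟧ℤ-neg (+ (m ℕ.* suc n)) ⟩
    - ((m ℕ.* suc n) ×ᴿ 1#)     ≈⟨ -‿cong (×1-homo-* m (suc n)) ⟩
    - (m ×ᴿ 1# * suc n ×ᴿ 1#)    ≈⟨ -‿distribʳ-* _ _ ⟩
    m ×ᴿ 1# * - (suc n ×ᴿ 1#)    ∎
  ⟦⟧ℤ-* -[1+ m ] (+ n) = begin
    ⟦ -[1+ m ] ℤ.* + n ⟧ℤ      ≡⟨ ≡.cong ⟦_⟧ℤ (ℤₚ.-◃n≡-n (suc m ℕ.* n)) ⟩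
    ⟦ ℤ.- + (suc m ℕ.* n) ⟧ℤ   ≈⟨ ⟦⟧ℤ-neg (+ (suc m ℕ.* n)) ⟩
    - ((suc m ℕ.* n) ×ᴿ 1#)     ≈⟨ -‿cong (×1-homo-* (suc m) n) ⟩
    - (suc m ×ᴿ 1# * n ×ᴿ 1#)    ≈⟨ -‿distribˡ-* _ _ ⟩
    - (suc m ×ᴿ 1#) * n ×ᴿ 1#    ∎
  ⟦⟧ℤ-* -[1+ m ] -[1+ n ] = begin
    (suc m ℕ.* suc n) ×ᴿ 1#             ≈⟨ ×1-homo-* (suc m) (suc n) ⟩
    suc m ×ᴿ 1# * suc n ×ᴿ 1#            ≈⟨ -‿involutive _ ⟨
    - - (suc m ×ᴿ 1# * suc n ×ᴿ 1#)      ≈⟨ -‿cong (-‿distribˡ-* _ _) ⟩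
    - (- (suc m ×ᴿ 1#) * suc n ×ᴿ 1#)    ≈⟨ -‿distribʳ-* _ _ ⟩
    - (suc m ×ᴿ 1#) * - (suc n ×ᴿ 1#)    ∎

  ℤ⟶R : ℤ.+-*-rawRing -Raw-AlmostCommutative⟶ fromCommutativeRing R
  ℤ⟶R = record
    { ⟦_⟧ = ⟦_⟧ℤ ; +-homo = ⟦⟧ℤ-+ ; *-homo = ⟦⟧ℤ-* ; -‿homo = ⟦⟧ℤ-neg ; 0-homo = refl ; 1-homo = refl }

  _≟ℤ_ : ∀ i j → Maybe (⟦ i ⟧ℤ ≈ ⟦ j ⟧ℤ)
  i ≟ℤ j with i ℤₚ.≟ j
  ... | yes ≡.refl = just refl
  ... | no  _      = nothing

  open Algebra.Solver.Ring ℤ.+-*-rawRing (fromCommutativeRing R) ℤ⟶R _≟ℤ_ public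
    using (Polynomial; solve; _:=_; _:+_; _:*_; _:-_; :-_; con)

-- Fields of characteristic zero with decidable equality.

record CharacteristicZeroField : Set₁ where
  field
    commutativeRing : CommutativeRing 0ℓ 0ℓ
  open CommutativeRing commutativeRing public hiding (zero)
  open Algebra.Definitions.RawSemiring (Semiring.rawSemiring semiring) public using (_^_) renaming (_×_ to _×ᴷ_)
  field
    _≟_     : Decidable _≈_
    inverse : ∀ {x} → ¬ x ≈ 0# → ∃ λ y → x * y ≈ 1#
    char0   : ∀ n → ¬ (suc n ×ᴷ 1# ≈ 0#)

module FieldProperties (K : CharacteristicZeroField) where
  open CharacteristicZeroField K
  open IntegerCoefficients commutativeRing using (solve; _:=_; _:+_; _:*_; _:-_; :-_; con)
  open Algebra.Properties.Group +-group public using () renaming (x∙y⁻¹≈ε⇒x≈y to x-y≈0⇒x≈y; x≈y⇒x∙y⁻¹≈ε to x≈y⇒x-y≈0)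
  open Algebra.Properties.Semiring.Exp semiring using (^-homo-*; ^-congˡ; ^-congʳ; ^-assocʳ) public
  open Algebra.Properties.CommutativeSemiring.Exp commutativeSemiring using (^-distrib-*) public
  open Algebra.Properties.Semiring.Mult semiring using (×-homo-+; ×1-homo-*)
  open Relation.Binary.Reasoning.Setoid setoid

  1≉0 : ¬ 1# ≈ 0#
  1≉0 1≈0 = char0 0 (trans (+-identityʳ 1#) 1≈0)

  1^ : ∀ n → 1# ^ n ≈ 1#
  1^ zero    = refl
  1^ (suc n) = trans (*-identityˡ _) (1^ n)

  stable : ∀ {x y} → ¬ ¬ x ≈ y → x ≈ y
  stable {x} {y} ¬¬p with x ≟ y
  ... | yes p = p
  ... | no ¬p = contradiction ¬p ¬¬p

  *-cancel-0 : ∀ {x y} → ¬ x ≈ 0# → x * y ≈ 0# → y ≈ 0#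
  *-cancel-0 {x} {y} x≉0 xy≈0 = begin
    y            ≈⟨ *-identityˡ y ⟨
    1# * y       ≈⟨ *-congʳ (proj₂ (inverse x≉0)) ⟨
    x * z * y    ≈⟨ solve 3 (λ x z y → x :* z :* y := z :* (x :* y)) refl x z y ⟩
    z * (x * y)  ≈⟨ *-congˡ xy≈0 ⟩
    z * 0#       ≈⟨ zeroʳ z ⟩
    0#           ∎
    where z = proj₁ (inverse x≉0)

  *-≉0 : ∀ {x y} → ¬ x ≈ 0# → ¬ y ≈ 0# → ¬ x * y ≈ 0#
  *-≉0 x≉0 y≉0 xy≈0 = y≉0 (*-cancel-0 x≉0 xy≈0)

  ^-≉0 : ∀ {x} n → ¬ x ≈ 0# → ¬ x ^ n ≈ 0#
  ^-≉0 zero    x≉0 = 1≉0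
  ^-≉0 (suc n) x≉0 = *-≉0 x≉0 (^-≉0 n x≉0)

  -- Corrects a root of a multiple of `z` to a root of `z`, given a root `r` of the inverse of the
  -- factor.
  *-^-multiple : ∀ n {r w k t z} → r ^ n ≈ k → w ^ n ≈ t * z → k * t ≈ 1# → (r * w) ^ n ≈ z
  *-^-multiple n {r} {w} {k} {t} {z} rⁿ≈k wⁿ≈tz kt≈1 = begin
    (r * w) ^ n    ≈⟨ ^-distrib-* r w n ⟩
    r ^ n * w ^ n  ≈⟨ *-cong rⁿ≈k wⁿ≈tz ⟩
    k * (t * z)    ≈⟨ *-assoc k t z ⟨
    k * t * z      ≈⟨ *-congʳ kt≈1 ⟩
    1# * z         ≈⟨ *-identityˡ z ⟩
    z              ∎

  -1*-assoc : ∀ x y → - 1# * x * y ≈ x * - y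
  -1*-assoc = solve 2 (λ x y → :- con (+ 1) :* x :* y := x :* :- y) refl

  -1^odd : ∀ l → (- 1#) ^ suc (2 ℕ.* l) ≈ - 1#
  -1^odd l = begin
    - 1# * (- 1#) ^ (2 ℕ.* l)   ≈⟨ *-congˡ (^-assocʳ (- 1#) 2 l) ⟨
    - 1# * ((- 1#) ^ 2) ^ l     ≈⟨ *-congˡ (^-congˡ l (solve 0 (:- con (+ 1) :* (:- con (+ 1) :* con (+ 1)) := con (+ 1)) refl)) ⟩
    - 1# * 1# ^ l               ≈⟨ *-congˡ (1^ l) ⟩
    - 1# * 1#                   ≈⟨ *-identityʳ _ ⟩
    - 1#                        ∎

  ×1-injective-< : ∀ {m n} → m ℕ.< n → ¬ m ×ᴷ 1# ≈ n ×ᴷ 1#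
  ×1-injective-< {m} {n} m<n eq = char0 (n ℕ.∸ suc m) (begin
    k                    ≈⟨ solve 2 (λ m k → k := (m :+ k) :- m) refl (m ×ᴷ 1#) k ⟩
    (m ×ᴷ 1# + k) - m ×ᴷ 1#  ≈⟨ +-congʳ (×-homo-+ 1# m (suc (n ℕ.∸ suc m))) ⟨
    (m ℕ.+ suc (n ℕ.∸ suc m)) ×ᴷ 1# - m ×ᴷ 1#  ≡⟨ ≡.cong (λ l → l ×ᴷ 1# - m ×ᴷ 1#) (≡.trans (ℕₚ.+-suc m _) (ℕₚ.m+[n∸m]≡n m<n)) ⟩
    n ×ᴷ 1# - m ×ᴷ 1#        ≈⟨ +-congʳ eq ⟨
    m ×ᴷ 1# - m ×ᴷ 1#        ≈⟨ -‿inverseʳ _ ⟩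
    0#                   ∎)
    where k = suc (n ℕ.∸ suc m) ×ᴷ 1#

  -- An element of infinite multiplicative order: its powers are distinct natural multiples of `1#`.
  -- Dilation by it separates the powers of a variable.
  two : Carrier
  two = 2 ×ᴷ 1#

  two^ : ∀ n → two ^ n ≈ (2 ℕ.^ n) ×ᴷ 1#
  two^ zero    = sym (+-identityʳ 1#)
  two^ (suc n) = trans (*-congˡ (two^ n)) (sym (×1-homo-* 2 (2 ℕ.^ n)))

  two^-injective-< : ∀ {m n} → m ℕ.< n → ¬ two ^ m ≈ two ^ n
  two^-injective-< {m} {n} m<n eq =
    ×1-injective-< (ℕₚ.^-monoʳ-< 2 (s≤s (s≤s z≤n)) m<n) (trans (sym (two^ m)) (trans eq (two^ n)))

-- Polynomial functions of one variable and their leading terms.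

module PolynomialFunctions (K : CharacteristicZeroField) where
  open CharacteristicZeroField K
  open FieldProperties K
  open IntegerCoefficients commutativeRing using (solve; _:=_; _:+_; _:*_; _:-_; :-_; con)
  open Relation.Binary.Reasoning.Setoid setoid

  data Deg< : ℕ → (Carrier → Carrier) → Set where
    vanishing : ∀ {f} → (∀ t → f t ≈ 0#) → Deg< 0 f
    top       : ∀ {d f} c → Deg< d (λ t → f t - c * t ^ d) → Deg< (suc d) f

  record Lead (d : ℕ) (c : Carrier) (f : Carrier → Carrier) : Set where
    constructor lead
    field
      remainder : Deg< d (λ t → f t - c * t ^ d)
  open Lead public

  Deg<-≡ : ∀ {d e f} → d ≡ e → Deg< d f → Deg< e f
  Deg<-≡ ≡.refl r = r

  Lead-≡ : ∀ {d e c f} → d ≡ e → Lead d c f → Lead e c f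
  Lead-≡ ≡.refl p = p

  Lead⇒Deg< : ∀ {d c f} → Lead d c f → Deg< (suc d) f
  Lead⇒Deg< {c = c} (lead r) = top c r

  Deg<-cong : ∀ {d f g} → (∀ t → f t ≈ g t) → Deg< d f → Deg< d g
  Deg<-cong f≗g (vanishing z) = vanishing λ t → trans (sym (f≗g t)) (z t)
  Deg<-cong f≗g (top c r)     = top c (Deg<-cong (λ t → +-congʳ (f≗g t)) r)

  Lead-cong : ∀ {d c c′ f g} → c ≈ c′ → (∀ t → f t ≈ g t) → Lead d c f → Lead d c′ g
  Lead-cong c≈c′ f≗g (lead r) =
    lead (Deg<-cong (λ t → +-cong (f≗g t) (-‿cong (*-congʳ c≈c′))) r)

  Deg<-+ : ∀ {d f g} → Deg< d f → Deg< d g → Deg< d (λ t → f t + g t)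
  Deg<-+ (vanishing y) (vanishing z) = vanishing λ t → trans (+-cong (y t) (z t)) (+-identityʳ 0#)
  Deg<-+ {suc d} {f} {g} (top b p) (top c q) = top (b + c) (Deg<-cong
    (λ t → solve 5 (λ f g b c x → (f :- b :* x) :+ (g :- c :* x) := (f :+ g) :- (b :+ c) :* x)
      refl (f t) (g t) b c (t ^ d))
    (Deg<-+ p q))

  Deg<-scale : ∀ {d f} a → Deg< d f → Deg< d (λ t → a * f t)
  Deg<-scale a (vanishing z) = vanishing λ t → trans (*-congˡ (z t)) (zeroʳ a)
  Deg<-scale {suc d} {f} a (top c r) = top (a * c) (Deg<-cong
    (λ t → solve 4 (λ a f c x → a :* (f :- c :* x) := a :* f :- a :* c :* x) refl a (f t) c (t ^ d))
    (Deg<-scale a r))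

  Deg<-neg : ∀ {d f} → Deg< d f → Deg< d (λ t → - f t)
  Deg<-neg {f = f} r = Deg<-cong (λ t → solve 1 (λ x → :- con (+ 1) :* x := :- x) refl (f t)) (Deg<-scale (- 1#) r)

  Deg<-minus : ∀ {d f g} → Deg< d f → Deg< d g → Deg< d (λ t → f t - g t)
  Deg<-minus p q = Deg<-+ p (Deg<-neg q)

  Deg<-suc : ∀ {d f} → Deg< d f → Deg< (suc d) f
  Deg<-suc {d} {f} r = top 0# (Deg<-cong
    (λ t → solve 2 (λ f x → f := f :- con (+ 0) :* x) refl (f t) (t ^ d)) r)

  Deg<-zero : ∀ d {f} → (∀ t → f t ≈ 0#) → Deg< d f
  Deg<-zero zero    z = vanishing z
  Deg<-zero (suc d) z = Deg<-suc (Deg<-zero d z)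

  Deg<-≤ : ∀ {d e f} → d ℕ.≤ e → Deg< d f → Deg< e f
  Deg<-≤ {e = e} z≤n (vanishing z) = Deg<-zero e z
  Deg<-≤ (s≤s d≤e) r = weaken d≤e r
    where
    weaken : ∀ {d e f} → d ℕ.≤ e → Deg< (suc d) f → Deg< (suc e) f
    weaken {d} {e} d≤e r with ℕₚ.m≤n⇒∃[o]m+o≡n d≤e
    ... | k , ≡.refl = Deg<-≡ (≡.cong suc (ℕₚ.+-comm k d)) (iterate k r)
      where
      iterate : ∀ k {f} → Deg< (suc d) f → Deg< (suc (k ℕ.+ d)) f
      iterate zero    r = r
      iterate (suc k) r = Deg<-suc (iterate k r)

  Deg<⇒Lead : ∀ {d f} → Deg< d f → Lead d 0# f
  Deg<⇒Lead {d} {f} r = lead (Deg<-cong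
    (λ t → solve 2 (λ f x → f := f :- con (+ 0) :* x) refl (f t) (t ^ d)) r)

  Deg<-monomial : ∀ d c → Deg< (suc d) (λ t → c * t ^ d)
  Deg<-monomial d c = top c (Deg<-zero d (λ t → -‿inverseʳ _))

  Lead-monomial : ∀ d c → Lead d c (λ t → c * t ^ d)
  Lead-monomial d c = lead (Deg<-zero d (λ t → -‿inverseʳ _))

  Deg<-const : ∀ c → Deg< 1 (λ _ → c)
  Deg<-const c = Deg<-cong (λ t → *-identityʳ c) (Deg<-monomial 0 c)

  Lead-+ : ∀ {d b c f g} → Lead d b f → Lead d c g → Lead d (b + c) (λ t → f t + g t)
  Lead-+ {d} {b} {c} {f} {g} (lead p) (lead q) = lead (Deg<-cong
    (λ t → solve 5 (λ f g b c x → (f :- b :* x) :+ (g :- c :* x) := (f :+ g) :- (b :+ c) :* x)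
      refl (f t) (g t) b c (t ^ d))
    (Deg<-+ p q))

  Lead-scale : ∀ {d c f} a → Lead d c f → Lead d (a * c) (λ t → a * f t)
  Lead-scale {d} {c} {f} a (lead r) = lead (Deg<-cong
    (λ t → solve 4 (λ a f c x → a :* (f :- c :* x) := a :* f :- a :* c :* x) refl a (f t) c (t ^ d))
    (Deg<-scale a r))

  Lead-+-Deg< : ∀ {d c f g} → Lead d c f → Deg< d g → Lead d c (λ t → f t + g t)
  Lead-+-Deg< p q = Lead-cong (+-identityʳ _) (λ _ → refl) (Lead-+ p (Deg<⇒Lead q))

  Deg<-shift : ∀ {d f} → Deg< d f → Deg< (suc d) (λ t → t * f t)
  Deg<-shift (vanishing z) = Deg<-zero 1 (λ t → trans (*-congˡ (z t)) (zeroʳ t))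
  Deg<-shift {suc d} {f} (top c r) = top c (Deg<-cong
    (λ t → solve 4 (λ f c x t → t :* (f :- c :* x) := t :* f :- c :* (t :* x)) refl (f t) c (t ^ d) t)
    (Deg<-shift r))

  Deg<-shift^ : ∀ e {d f} → Deg< d f → Deg< (e ℕ.+ d) (λ t → t ^ e * f t)
  Deg<-shift^ zero    r = Deg<-cong (λ t → sym (*-identityˡ _)) r
  Deg<-shift^ (suc e) r = Deg<-cong (λ t → sym (*-assoc t _ _)) (Deg<-shift (Deg<-shift^ e r))

  -- The two bounds enter asymmetrically to avoid a predecessor: degrees at most d - 1 and e add up
  -- to less than d + e.
  Deg<-* : ∀ {d e f g} → Deg< d f → Deg< (suc e) g → Deg< (d ℕ.+ e) (λ t → f t * g t)
  Deg<-* {e = e} (vanishing z) q = Deg<-zero e (λ t → trans (*-congʳ (z t)) (zeroˡ _))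
  Deg<-* {suc d} {e} {f} {g} (top c r) q = Deg<-cong
    (λ t → solve 4 (λ f g c x → c :* (x :* g) :+ (f :- c :* x) :* g := f :* g)
      refl (f t) (g t) c (t ^ d))
    (Deg<-+ (Deg<-≡ (ℕₚ.+-suc d e) (Deg<-scale c (Deg<-shift^ d q)))
            (Deg<-suc (Deg<-* r q)))

  Lead-* : ∀ {d e b c f g} → Lead d b f → Lead e c g → Lead (d ℕ.+ e) (b * c) (λ t → f t * g t)
  Lead-* {d} {e} {b} {c} {f} {g} p q = lead (Deg<-cong
    (λ t → trans
      (solve 6 (λ f g b c x y → (b :* (x :* (g :- c :* y))) :+ (f :- b :* x) :* g := f :* g :- b :* c :* (x :* y))
        refl (f t) (g t) b c (t ^ d) (t ^ e))
      (+-congˡ (-‿cong (*-congˡ (sym (^-homo-* t d e))))))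
    (Deg<-+ (Deg<-scale b (Deg<-shift^ d (remainder q))) (Deg<-* (remainder p) (Lead⇒Deg< q))))

  Lead-^ : ∀ {d c f} n → Lead d c f → Lead (n ℕ.* d) (c ^ n) (λ t → f t ^ n)
  Lead-^ zero    p = Lead-cong refl (λ _ → *-identityʳ 1#) (Lead-monomial 0 1#)
  Lead-^ (suc n) p = Lead-* p (Lead-^ n p)

  Deg<-∘ : ∀ {m p f g} → Deg< (suc m) f → Deg< (suc p) g → Deg< (suc (m ℕ.* p)) (λ t → f (g t))
  Deg<-∘ {m} {p} {f} {g} (top c r) q@(top b s) = Deg<-cong
    (λ t → solve 3 (λ f c x → c :* x :+ (f :- c :* x) := f) refl (f (g t)) c (g t ^ m))
    (Deg<-+ (Deg<-scale c (Lead⇒Deg< (Lead-^ m (lead {c = b} s)))) (lower r))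
    where
    lower : ∀ {m f} → Deg< m f → Deg< (suc (m ℕ.* p)) (λ t → f (g t))
    lower (vanishing z) = Deg<-zero _ (λ t → z (g t))
    lower {suc m} r@(top _ _) = Deg<-≤ (s≤s (ℕₚ.m≤n+m (m ℕ.* p) p)) (Deg<-∘ r q)

  -- If p were 0, all terms of `f` would land in degree 0 and the lower ones would change the
  -- leading coefficient.
  Lead-∘ : ∀ {m p b c f g} → 1 ℕ.≤ p → Lead m c f → Lead p b g → Lead (m ℕ.* p) (c * b ^ m) (λ t → f (g t))
  Lead-∘ {m} {p} {b} {c} {f} {g} 1≤p (lead r) q = Lead-cong refl
    (λ t → solve 3 (λ f c x → c :* x :+ (f :- c :* x) := f) refl (f (g t)) c (g t ^ m))
    (Lead-+-Deg< (Lead-scale c (Lead-^ m q)) (lower r))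
    where
    lower : ∀ {m f} → Deg< m f → Deg< (m ℕ.* p) (λ t → f (g t))
    lower (vanishing z) = Deg<-zero _ (λ t → z (g t))
    lower {suc m} r@(top _ _) = Deg<-≤ (ℕₚ.+-monoˡ-≤ (m ℕ.* p) 1≤p) (Deg<-∘ r (Lead⇒Deg< q))

  -- The operator f(t) ↦ f(2t) - 2ᴺ f(t) annihilates t ^ N but no lower power of t.
  monomial-¬Deg< : ∀ {d N k g} → Deg< d g → (∀ t → g t ≈ k * t ^ N) → d ℕ.≤ N → k ≈ 0#
  monomial-¬Deg< {N = N} {k} (vanishing z) g≗ _ = trans (sym (trans (g≗ 1#) (trans (*-congˡ (1^ N)) (*-identityʳ k)))) (z 1#)
  monomial-¬Deg< {suc d} {N} {k} {g} (top e r) g≗ d<N = monomial-¬Deg<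
    (Deg<-cong (λ t → trans (+-congˡ (-‿cong (trans (*-congʳ e≈0) (zeroˡ _)))) (solve 1 (λ x → x :- con (+ 0) := x) refl (g t))) r)
    g≗ (ℕₚ.<⇒≤ d<N)
    where
    twice : Deg< d (λ t → (g (two * t) - e * (two * t) ^ d) - two ^ N * (g t - e * t ^ d))
    twice = Deg<-minus (double r) (Deg<-scale (two ^ N) r)
      where
      double : ∀ {d f} → Deg< d f → Deg< d (λ t → f (two * t))
      double (vanishing z) = vanishing λ t → z (two * t)
      double {suc d} {f} (top c r) = top (c * two ^ d) (Deg<-cong
        (λ t → +-congˡ (-‿cong (trans (*-congˡ (^-distrib-* two t d)) (sym (*-assoc _ _ _)))))
        (double r))
    e≈0 : e ≈ 0#
    -- `twice` bounds by d the degree of e (2ᴺ - 2ᵈ) tᵈ, so the induction applies with d as the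
    -- exponent; since 2ᴺ ≠ 2ᵈ, only e = 0 is left.
    e≈0 = stable λ e≉0 → *-≉0 e≉0
      (λ eq → two^-injective-< d<N (sym (x-y≈0⇒x≈y _ _ eq)))
      (monomial-¬Deg< twice (λ t → begin
        (g (two * t) - e * (two * t) ^ d) - two ^ N * (g t - e * t ^ d)
          ≈⟨ +-cong (+-cong (trans (g≗ _) (*-congˡ (^-distrib-* two t N))) (-‿cong (*-congˡ (^-distrib-* two t d))))
                    (-‿cong (*-congˡ (+-congʳ (g≗ t)))) ⟩
        (k * (two ^ N * t ^ N) - e * (two ^ d * t ^ d)) - two ^ N * (k * t ^ N - e * t ^ d)
          ≈⟨ solve 6 (λ k e N D x y → (k :* (N :* x) :- e :* (D :* y)) :- N :* (k :* x :- e :* y) := e :* (N :- D) :* y)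
               refl k e (two ^ N) (two ^ d) (t ^ N) (t ^ d) ⟩
        e * (two ^ N - two ^ d) * t ^ d ∎) ℕₚ.≤-refl)

  Lead-Deg<⇒0 : ∀ {d e c f} → Lead e c f → Deg< d f → d ℕ.≤ e → c ≈ 0#
  Lead-Deg<⇒0 {e = e} {c} {f} (lead r) q d≤e = monomial-¬Deg< (Deg<-minus (Deg<-≤ d≤e q) r)
    (λ t → solve 2 (λ f x → f :- (f :- x) := x) refl (f t) (c * t ^ e)) ℕₚ.≤-refl

  Lead-unique : ∀ {d b c f} → Lead d b f → Lead d c f → b ≈ c
  Lead-unique {d} {b} {c} {f} (lead p) (lead q) = x-y≈0⇒x≈y _ _ (monomial-¬Deg< (Deg<-minus q p)
    (λ t → solve 4 (λ f b c x → (f :- c :* x) :- (f :- b :* x) := (b :- c) :* x) refl (f t) b c (t ^ d)) ℕₚ.≤-refl)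

  Lead-0 : ∀ {d c f} → Lead d c f → (∀ t → f t ≈ 0#) → c ≈ 0#
  Lead-0 p z = Lead-Deg<⇒0 p (vanishing z) z≤n

  Lead-0⇒Deg< : ∀ {d c f} → Lead d c f → c ≈ 0# → Deg< d f
  Lead-0⇒Deg< {d} {c} {f} (lead r) c≈0 = Deg<-cong
    (λ t → trans (+-congˡ (-‿cong (*-congʳ c≈0))) (solve 2 (λ f x → f :- con (+ 0) :* x := f) refl (f t) (t ^ d))) r

  zero-or-Lead : ∀ {d f} → Deg< d f → (∀ t → f t ≈ 0#) ⊎ ∃₂ λ e c → ¬ c ≈ 0# × Lead e c f
  zero-or-Lead (vanishing z) = inj₁ z
  zero-or-Lead {suc d} (top c r) with c ≟ 0#
  ... | no  c≉0 = inj₂ (d , c , c≉0 , lead r)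
  ... | yes c≈0 = zero-or-Lead (Lead-0⇒Deg< (lead r) c≈0)

  zero-product : ∀ {d e f g} → Deg< d f → Deg< e g → (∀ t → f t * g t ≈ 0#) → ∀ {s} → ¬ f s ≈ 0# → ∀ t → g t ≈ 0#
  zero-product p q fg≈0 {s} fs≉0 with zero-or-Lead p | zero-or-Lead q
  ... | inj₁ f≈0                | _                       = contradiction (f≈0 s) fs≉0
  ... | inj₂ _                  | inj₁ g≈0                = g≈0
  ... | inj₂ (_ , _ , b≉0 , lf) | inj₂ (_ , _ , c≉0 , lg) = contradiction (Lead-0 (Lead-* lf lg) fg≈0) (*-≉0 b≉0 c≉0)

  -- If `f` were nonzero, the composite would have a nonzero leading coefficient. Surjectivity of
  -- `g`, and with it algebraic closedness, is thereby avoided.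
  vanishing-on-image : ∀ {d f p b g} → Deg< d f → 1 ℕ.≤ p → ¬ b ≈ 0# → Lead p b g →
                       (∀ t → f (g t) ≈ 0#) → ∀ t → f t ≈ 0#
  vanishing-on-image r 1≤p b≉0 lg fg≈0 with zero-or-Lead r
  ... | inj₁ f≈0                = f≈0
  ... | inj₂ (e , c , c≉0 , lf) =
    contradiction (Lead-0 (Lead-∘ 1≤p lf lg) fg≈0) (*-≉0 c≉0 (^-≉0 e b≉0))

  -- The part of the binomial expansion linear in `D` dominates because deg D < deg b. The induction
  -- rests on (b + D) X - b Y = (b + D)(X - Y) + D Y.
  Lead-power-difference : ∀ {p r β δ b D} m → r ℕ.< p → Lead p β b → Lead r δ D →
    Lead (m ℕ.* p ℕ.+ r) (suc m ×ᴷ 1# * (β ^ m * δ)) (λ t → (b t + D t) ^ suc m - b t ^ suc m)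
  Lead-power-difference {β = β} {δ} {b} {D} zero r<p lb lD = Lead-cong
    (solve 1 (λ d → d := (con (+ 1) :+ con (+ 0)) :* (con (+ 1) :* d)) refl δ)
    (λ t → solve 2 (λ b d → d := (b :+ d) :* con (+ 1) :- b :* con (+ 1)) refl (b t) (D t)) lD
  Lead-power-difference {p} {r} {β} {δ} {b} {D} (suc m) r<p lb lD = Lead-cong
    (solve 4 (λ β d B n → β :* (n :* (B :* d)) :+ d :* (β :* B) := (con (+ 1) :+ n) :* (β :* B :* d))
      refl β δ (β ^ m) (suc m ×ᴷ 1#))
    (λ t → solve 4 (λ b d X Y → (b :+ d) :* (X :- Y) :+ d :* Y := (b :+ d) :* X :- b :* Y)
      refl (b t) (D t) ((b t + D t) ^ suc m) (b t ^ suc m))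
    (Lead-+
      (Lead-≡ (≡.sym (ℕₚ.+-assoc p (m ℕ.* p) r))
        (Lead-* (Lead-+-Deg< lb (Deg<-≤ r<p (Lead⇒Deg< lD))) (Lead-power-difference m r<p lb lD)))
      (Lead-≡ (ℕₚ.+-comm r (suc m ℕ.* p)) (Lead-* lD (Lead-^ (suc m) lb))))

-- Formal polynomials as functions: evaluation is well defined and injective.

module Evaluation (K : CharacteristicZeroField) where
  open CharacteristicZeroField K
  open FieldProperties K
  open PolynomialFunctions K
  open IntegerCoefficients commutativeRing using (solve; _:=_; _:+_; _:*_; _:-_; :-_; con)
  open Polynomials commutativeRing
  open Algebra.Properties.Ring ring using (-1*x≈-x)
  open Relation.Binary.Reasoning.Setoid setoid

  Point : ℕ → Set
  Point k = Fin k → Carrier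

  mono : ∀ {k} → Point k → Vec ℕ k → Carrier
  mono x []      = 1#
  mono x (a ∷ α) = x zero ^ a * mono (x ∘ suc) α

  eval : ∀ {k} → Poly k → Point k → Carrier
  eval []            x = 0#
  eval ((a , α) ∷ p) x = a * mono x α + eval p x

  mono-cong : ∀ {k} {x y : Point k} → (∀ i → x i ≈ y i) → ∀ α → mono x α ≈ mono y α
  mono-cong x≗y []      = refl
  mono-cong x≗y (a ∷ α) = *-cong (^-congˡ a (x≗y zero)) (mono-cong (x≗y ∘ suc) α)

  eval-cong : ∀ {k} (p : Poly k) {x y : Point k} → (∀ i → x i ≈ y i) → eval p x ≈ eval p y
  eval-cong []            x≗y = refl
  eval-cong ((a , α) ∷ p) x≗y = +-cong (*-congˡ (mono-cong x≗y α)) (eval-cong p x≗y)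

  mono-0 : ∀ {k} (x : Point k) → mono x (replicate k 0) ≈ 1#
  mono-0 {zero}  x = refl
  mono-0 {suc k} x = trans (*-identityˡ _) (mono-0 (x ∘ suc))

  mono-unit : ∀ {k} (x : Point k) i → mono x (replicate k 0 [ i ]≔ 1) ≈ x i
  mono-unit x zero    = trans (*-cong (*-identityʳ _) (mono-0 (x ∘ suc))) (*-identityʳ _)
  mono-unit x (suc i) = trans (*-identityˡ _) (mono-unit (x ∘ suc) i)

  mono-+ : ∀ {k} (x : Point k) α β → mono x (zipWith ℕ._+_ α β) ≈ mono x α * mono x β
  mono-+ x []      []      = sym (*-identityˡ 1#)
  mono-+ x (a ∷ α) (b ∷ β) = trans (*-cong (^-homo-* (x zero) a b) (mono-+ (x ∘ suc) α β))
    (solve 4 (λ p q r s → (p :* q) :* (r :* s) := (p :* r) :* (q :* s)) refl _ _ _ _)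

  eval-monomial : ∀ {k} a (α : Vec ℕ k) x → eval (monomial a α) x ≈ a * mono x α
  eval-monomial a α x = +-identityʳ _

  eval-const : ∀ {k} a (x : Point k) → eval (const a) x ≈ a
  eval-const a x = trans (+-identityʳ _) (trans (*-congˡ (mono-0 x)) (*-identityʳ a))

  eval-X : ∀ {k} i (x : Point k) → eval (X i) x ≈ x i
  eval-X i x = trans (+-identityʳ _) (trans (*-identityˡ _) (mono-unit x i))

  eval-+ : ∀ {k} (p q : Poly k) x → eval (p +ₚ q) x ≈ eval p x + eval q x
  eval-+ []            q x = sym (+-identityˡ _)
  eval-+ ((a , α) ∷ p) q x = trans (+-congˡ (eval-+ p q x)) (sym (+-assoc _ _ _))

  eval-* : ∀ {k} (p q : Poly k) x → eval (p *ₚ q) x ≈ eval p x * eval q x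
  eval-* []            q x = sym (zeroˡ _)
  eval-* ((a , α) ∷ p) q x = begin
    eval (List.map shift q ++ p *ₚ q) x          ≈⟨ eval-+ (List.map shift q) (p *ₚ q) x ⟩
    eval (List.map shift q) x + eval (p *ₚ q) x  ≈⟨ +-cong (eval-shift q) (eval-* p q x) ⟩
    a * mono x α * eval q x + eval p x * eval q x ≈⟨ distribʳ _ _ _ ⟨
    (a * mono x α + eval p x) * eval q x         ∎
    where
    shift : Carrier × Vec ℕ _ → Carrier × Vec ℕ _
    shift (b , β) = a * b , zipWith ℕ._+_ α β
    eval-shift : ∀ q → eval (List.map shift q) x ≈ a * mono x α * eval q x
    eval-shift []            = sym (zeroʳ _)
    eval-shift ((b , β) ∷ q) = trans (+-cong (*-congˡ (mono-+ x α β)) (eval-shift q))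
      (solve 5 (λ a b m n e → a :* b :* (m :* n) :+ a :* m :* e := a :* m :* (b :* n :+ e)) refl
        a b (mono x α) (mono x β) (eval q x))

  eval-^ : ∀ {k} (p : Poly k) n x → eval (p ^ₚ n) x ≈ eval p x ^ n
  eval-^ p zero    x = eval-const 1# x
  eval-^ p (suc n) x = trans (eval-* p (p ^ₚ n) x) (*-congˡ (eval-^ p n x))

  eval-power : ∀ {k l} (f : Fin k → Poly l) α x → eval (power f α) x ≈ mono (λ i → eval (f i) x) α
  eval-power f []      x = eval-const 1# x
  eval-power f (a ∷ α) x = trans (eval-* (f zero ^ₚ a) (power (f ∘ suc) α) x)
    (*-cong (eval-^ (f zero) a x) (eval-power (f ∘ suc) α x))

  eval-⟦⟧ : ∀ {k l} (p : Poly k) (f : Fin k → Poly l) x → eval (p ⟦ f ⟧) x ≈ eval p (λ i → eval (f i) x)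
  eval-⟦⟧ []            f x = refl
  eval-⟦⟧ ((a , α) ∷ p) f x = begin
    eval (const a *ₚ power f α +ₚ p ⟦ f ⟧) x         ≈⟨ eval-+ (const a *ₚ power f α) (p ⟦ f ⟧) x ⟩
    eval (const a *ₚ power f α) x + eval (p ⟦ f ⟧) x ≈⟨ +-cong (eval-* (const a) (power f α) x) (eval-⟦⟧ p f x) ⟩
    eval (const a) x * eval (power f α) x + eval p (λ i → eval (f i) x)
                                                     ≈⟨ +-congʳ (*-cong (eval-const a x) (eval-power f α x)) ⟩
    eval ((a , α) ∷ p) (λ i → eval (f i) x)          ∎

  infix 4 _≟ᵛ_
  _≟ᵛ_ : ∀ {k} (α β : Vec ℕ k) → _
  _≟ᵛ_ = Vecₚ.≡-dec ℕₚ._≟_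

  coeff-here : ∀ {k} a (α : Vec ℕ k) p → coeff ((a , α) ∷ p) α ≡ a + coeff p α
  coeff-here a α p with α ≟ᵛ α
  ... | yes _   = ≡.refl
  ... | no  α≢α = contradiction ≡.refl α≢α

  coeff-there : ∀ {k} {α β : Vec ℕ k} a p → α ≢ β → coeff ((a , α) ∷ p) β ≡ coeff p β
  coeff-there {α = α} {β} a p α≢β with α ≟ᵛ β
  ... | yes α≡β = contradiction α≡β α≢β
  ... | no  _   = ≡.refl

  coeff-++ : ∀ {k} (p q : Poly k) α → coeff (p +ₚ q) α ≈ coeff p α + coeff q α
  coeff-++ []            q β = sym (+-identityˡ _)
  coeff-++ ((a , α) ∷ p) q β with α ≟ᵛ β
  ... | yes _ = trans (+-congˡ (coeff-++ p q β)) (sym (+-assoc _ _ _))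
  ... | no  _ = coeff-++ p q β

  -- Serves both for scalar multiples, with a constant weight, and for the dilation of a variable,
  -- where the weight is a power read off the exponent.
  reweight : ∀ {k} → (Vec ℕ k → Carrier) → Poly k → Poly k
  reweight w = List.map λ (a , α) → w α * a , α

  coeff-reweight : ∀ {k} w (p : Poly k) α → coeff (reweight w p) α ≈ w α * coeff p α
  coeff-reweight w []            β = sym (zeroʳ _)
  coeff-reweight w ((a , α) ∷ p) β with α ≟ᵛ β
  ... | yes ≡.refl = trans (+-congˡ (coeff-reweight w p β)) (sym (distribˡ _ _ _))
  ... | no  _      = coeff-reweight w p β

  eval-reweight-const : ∀ {k} c (p : Poly k) x → eval (reweight (λ _ → c) p) x ≈ c * eval p x
  eval-reweight-const c []            x = sym (zeroʳ c)
  eval-reweight-const c ((a , α) ∷ p) x = trans (+-congˡ (eval-reweight-const c p x))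
    (solve 4 (λ c a m e → c :* a :* m :+ c :* e := c :* (a :* m :+ e)) refl c a (mono x α) (eval p x))

  negate : ∀ {k} → Poly k → Poly k
  negate = reweight λ _ → - 1#

  eval-negate : ∀ {k} (p : Poly k) x → eval (negate p) x ≈ - eval p x
  eval-negate p x = trans (eval-reweight-const (- 1#) p x) (-1*x≈-x _)

  coeff-negate : ∀ {k} (p : Poly k) α → coeff (negate p) α ≈ - coeff p α
  coeff-negate p α = trans (coeff-reweight _ p α) (-1*x≈-x _)

  without : ∀ {k} → Vec ℕ k → Poly k → Poly k
  without α []            = []
  without α ((b , β) ∷ p) with β ≟ᵛ α
  ... | yes _ = without α p
  ... | no  _ = (b , β) ∷ without α p

  length-without : ∀ {k} (α : Vec ℕ k) p → length (without α p) ℕ.≤ length p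
  length-without α []            = z≤n
  length-without α ((b , β) ∷ p) with β ≟ᵛ α
  ... | yes _ = ℕₚ.m≤n⇒m≤1+n (length-without α p)
  ... | no  _ = s≤s (length-without α p)

  eval-without : ∀ {k} (α : Vec ℕ k) p x → eval p x ≈ coeff p α * mono x α + eval (without α p) x
  eval-without α []            x = solve 1 (λ m → con (+ 0) := con (+ 0) :* m :+ con (+ 0)) refl _
  eval-without α ((b , β) ∷ p) x with β ≟ᵛ α
  ... | yes ≡.refl = trans (+-congˡ (eval-without α p x))
    (solve 4 (λ b m c e → b :* m :+ (c :* m :+ e) := (b :+ c) :* m :+ e) refl b (mono x α) _ _)
  ... | no  _      = trans (+-congˡ (eval-without α p x))
    (solve 3 (λ b c e → b :+ (c :+ e) := c :+ (b :+ e)) refl _ _ _)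

  coeff-without-≡ : ∀ {k} (α : Vec ℕ k) p → coeff (without α p) α ≈ 0#
  coeff-without-≡ α []            = refl
  coeff-without-≡ α ((b , β) ∷ p) with β ≟ᵛ α
  ... | yes _   = coeff-without-≡ α p
  ... | no  β≢α = trans (reflexive (coeff-there b (without α p) β≢α)) (coeff-without-≡ α p)

  coeff-without-≢ : ∀ {k} {α β : Vec ℕ k} p → α ≢ β → coeff (without α p) β ≈ coeff p β
  coeff-without-≢ []            α≢β = refl
  coeff-without-≢ {α = α} {β} ((c , γ) ∷ p) α≢β with γ ≟ᵛ α
  ... | yes ≡.refl = trans (coeff-without-≢ p α≢β) (reflexive (≡.sym (coeff-there c p α≢β)))
  ... | no  _ with γ ≟ᵛ β
  ...   | yes _ = +-congˡ (coeff-without-≢ p α≢β)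
  ...   | no  _ = coeff-without-≢ p α≢β

  -- An exponent may recur in the list, so single terms need not vanish. All terms with the exponent
  -- of the head are removed together, and the recursion is on the length.
  eval-zero : ∀ {k} {p : Poly k} → p ≈ₚ [] → ∀ x → eval p x ≈ 0#
  eval-zero {k} {p} p≈0 x = go (length p) p ℕₚ.≤-refl p≈0
    where
    go : ∀ n (p : Poly k) → length p ℕ.≤ n → p ≈ₚ [] → eval p x ≈ 0#
    go n       []                _         p≈0 = refl
    go (suc n) p′@((a , α) ∷ p) (s≤s p≤n) p≈0 = begin
      eval p′ x                                        ≈⟨ eval-without α p′ x ⟩
      coeff p′ α * mono x α + eval (without α p′) x    ≈⟨ +-cong (*-congʳ (p≈0 α)) (go n (without α p′) shorter vanishes) ⟩
      0# * mono x α + 0#                               ≈⟨ solve 1 (λ m → con (+ 0) :* m :+ con (+ 0) := con (+ 0)) refl _ ⟩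
      0#                                               ∎
      where
      shorter : length (without α p′) ℕ.≤ n
      shorter with α ≟ᵛ α
      ... | yes _   = ℕₚ.≤-trans (length-without α p) p≤n
      ... | no  α≢α = contradiction ≡.refl α≢α
      vanishes : without α p′ ≈ₚ []
      vanishes β with α ≟ᵛ β
      ... | yes ≡.refl = coeff-without-≡ α p′
      ... | no  α≢β    = trans (coeff-without-≢ p′ α≢β) (p≈0 β)

  eval-resp : ∀ {k} {p q : Poly k} → p ≈ₚ q → ∀ x → eval p x ≈ eval q x
  eval-resp {p = p} {q} p≈q x = x-y≈0⇒x≈y _ _ (begin
    eval p x - eval q x         ≈⟨ +-congˡ (eval-negate q x) ⟨
    eval p x + eval (negate q) x ≈⟨ eval-+ p (negate q) x ⟨
    eval (p +ₚ negate q) x      ≈⟨ eval-zero {p = p +ₚ negate q} (λ α → trans (coeff-++ p (negate q) α)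
                                     (trans (+-congˡ (coeff-negate q α)) (x≈y⇒x-y≈0 (p≈q α)))) x ⟩
    0#                          ∎)

  -- A polynomial is read as one in its first variable; this is the coefficient of the `j`-th power,
  -- a polynomial in the others.
  slice : ∀ {k} → ℕ → Poly (suc k) → Poly k
  slice j []                = []
  slice j ((a , i ∷ α) ∷ p) with i ℕₚ.≟ j
  ... | yes _ = (a , α) ∷ slice j p
  ... | no  _ = slice j p

  coeff-slice : ∀ {k} j (p : Poly (suc k)) α → coeff (slice j p) α ≈ coeff p (j ∷ α)
  coeff-slice j []                β = refl
  coeff-slice j ((a , i ∷ α) ∷ p) β with i ℕₚ.≟ j
  ... | no  i≢j = trans (coeff-slice j p β) (reflexive (≡.sym (coeff-there {α = i ∷ α} a p (λ eq → i≢j (Vecₚ.∷-injectiveˡ eq)))))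
  ... | yes ≡.refl = go (α ≟ᵛ β)
    where
    go : Dec (α ≡ β) → coeff ((a , α) ∷ slice i p) β ≈ coeff ((a , i ∷ α) ∷ p) (i ∷ β)
    go (yes ≡.refl) = trans (reflexive (coeff-here a α (slice i p)))
      (trans (+-congˡ (coeff-slice i p α)) (reflexive (≡.sym (coeff-here a (i ∷ α) p))))
    go (no α≢β)     = trans (reflexive (coeff-there a (slice i p) α≢β))
      (trans (coeff-slice i p β) (reflexive (≡.sym (coeff-there {α = i ∷ α} a p (λ eq → α≢β (Vecₚ.∷-injectiveʳ eq))))))

  withoutHead : ∀ {k} → ℕ → Poly (suc k) → Poly (suc k)
  withoutHead j []                = []
  withoutHead j ((a , i ∷ α) ∷ p) with i ℕₚ.≟ j
  ... | yes _ = withoutHead j p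
  ... | no  _ = (a , i ∷ α) ∷ withoutHead j p

  infixr 5 _∷ᵖ_
  _∷ᵖ_ : ∀ {k} → Carrier → Point k → Point (suc k)
  (t ∷ᵖ x) zero    = t
  (t ∷ᵖ x) (suc i) = x i

  eval-slice : ∀ {k} j (p : Poly (suc k)) t x →
               eval p (t ∷ᵖ x) - eval (slice j p) x * t ^ j ≈ eval (withoutHead j p) (t ∷ᵖ x)
  eval-slice j []                t x = solve 1 (λ m → con (+ 0) :- con (+ 0) :* m := con (+ 0)) refl _
  eval-slice j ((a , i ∷ α) ∷ p) t x with i ℕₚ.≟ j
  ... | yes ≡.refl = trans
    (solve 5 (λ a u m e s → a :* (u :* m) :+ e :- (a :* m :+ s) :* u := e :- s :* u) refl a (t ^ j) (mono x α) _ _)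
    (eval-slice j p t x)
  ... | no  _ = trans
    (solve 3 (λ a e s → (a :+ e) :- s := a :+ (e :- s)) refl _ _ _)
    (+-congˡ (eval-slice j p t x))

  slice-withoutHead : ∀ {k i j} (p : Poly (suc k)) → i ≢ j → slice i (withoutHead j p) ≡ slice i p
  slice-withoutHead         []                i≢j = ≡.refl
  slice-withoutHead {i = i} {j} ((a , l ∷ α) ∷ p) i≢j with l ℕₚ.≟ j
  slice-withoutHead {i = i} {j} ((a , l ∷ α) ∷ p) i≢j | yes ≡.refl with l ℕₚ.≟ i
  ... | yes ≡.refl = contradiction ≡.refl i≢j
  ... | no  _      = slice-withoutHead p i≢j
  slice-withoutHead {i = i} {j} ((a , l ∷ α) ∷ p) i≢j | no  _ with l ℕₚ.≟ i
  ... | yes ≡.refl = ≡.cong ((a , α) ∷_) (slice-withoutHead p i≢j)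
  ... | no  _      = slice-withoutHead p i≢j

  HeadsBelow : ∀ {k} → ℕ → Poly (suc k) → Set
  HeadsBelow D = All λ (_ , α) → Vec.head α ℕ.< D

  withoutHead-below : ∀ {k d} {p : Poly (suc k)} → HeadsBelow (suc d) p → HeadsBelow d (withoutHead d p)
  withoutHead-below []                                         = []
  withoutHead-below {d = d} {(_ , i ∷ _) ∷ _} (s≤s i≤d ∷ bs) with i ℕₚ.≟ d
  ... | yes _   = withoutHead-below bs
  ... | no  i≢d = ℕₚ.≤∧≢⇒< i≤d i≢d ∷ withoutHead-below bs

  headsBelow : ∀ {k} (p : Poly (suc k)) → ∃ λ D → HeadsBelow D p
  headsBelow []                = 0 , []
  headsBelow ((_ , i ∷ _) ∷ p) with headsBelow p
  ... | D , bs = suc i ℕ.⊔ D , ℕₚ.m≤m⊔n (suc i) D ∷ All.map (λ b → ℕₚ.<-≤-trans b (ℕₚ.m≤n⊔m (suc i) D)) bs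

  Deg<-head : ∀ {k D} {p : Poly (suc k)} → HeadsBelow D p → ∀ x → Deg< D (λ t → eval p (t ∷ᵖ x))
  Deg<-head {D = zero}  {[]}    _  x = vanishing λ _ → refl
  Deg<-head {D = zero}  {_ ∷ _} (() ∷ _)
  Deg<-head {D = suc d} {p} bs x = top (eval (slice d p) x)
    (Deg<-cong (λ t → sym (eval-slice d p t x)) (Deg<-head (withoutHead-below bs) x))

  slice-top≈0 : ∀ {k d} {p : Poly (suc k)} → HeadsBelow (suc d) p → ∀ x →
                (∀ t → eval p (t ∷ᵖ x) ≈ 0#) → eval (slice d p) x ≈ 0#
  slice-top≈0 {d = d} {p} bs x z =
    Lead-0 (lead (Deg<-cong (λ t → sym (eval-slice d p t x)) (Deg<-head (withoutHead-below bs) x))) z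

  slice-vanishes : ∀ {k D} {p : Poly (suc k)} → HeadsBelow D p → ∀ x →
                   (∀ t → eval p (t ∷ᵖ x) ≈ 0#) → ∀ j → eval (slice j p) x ≈ 0#
  slice-vanishes {D = zero}  {[]} _  x z j = refl
  slice-vanishes {D = zero}  {_ ∷ _} (() ∷ _)
  slice-vanishes {D = suc d} {p} bs x z j with j ℕₚ.≟ d
  ... | yes ≡.refl = slice-top≈0 bs x z
  ... | no  j≢d    = trans (reflexive (≡.cong (λ q → eval q x) (≡.sym (slice-withoutHead p j≢d))))
    (slice-vanishes (withoutHead-below bs) x
      (λ t → trans (sym (eval-slice d p t x)) (trans (+-cong (z t) (-‿cong (*-congʳ (slice-top≈0 bs x z))))
        (solve 1 (λ m → con (+ 0) :- con (+ 0) :* m := con (+ 0)) refl _))) j)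

  -- Induction on the number of variables. For fixed values of the others, a polynomial in the first
  -- variable that vanishes everywhere has vanishing coefficients, which are values of the slices.
  eval-injective-0 : ∀ {k} (p : Poly k) → (∀ x → eval p x ≈ 0#) → p ≈ₚ []
  eval-injective-0 {zero} p z [] = trans (coeff-eval p) (z λ ())
    where
    coeff-eval : ∀ p → coeff p [] ≈ eval p (λ ())
    coeff-eval []             = refl
    coeff-eval ((a , []) ∷ p) = +-cong (sym (*-identityʳ a)) (coeff-eval p)
  eval-injective-0 {suc k} p z (j ∷ α) = trans (sym (coeff-slice j p α))
    (eval-injective-0 (slice j p) (λ x → slice-vanishes (proj₂ (headsBelow p)) x (λ t → z (t ∷ᵖ x)) j) α)

  eval-injective : ∀ {k} {p q : Poly k} → (∀ x → eval p x ≈ eval q x) → p ≈ₚ q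
  eval-injective {p = p} {q} p≗q α = x-y≈0⇒x≈y _ _ (begin
    coeff p α - coeff q α          ≈⟨ +-congˡ (coeff-negate q α) ⟨
    coeff p α + coeff (negate q) α ≈⟨ coeff-++ p (negate q) α ⟨
    coeff (p +ₚ negate q) α        ≈⟨ eval-injective-0 (p +ₚ negate q) (λ x → trans (eval-+ p (negate q) x)
                                        (trans (+-congˡ (eval-negate q x)) (x≈y⇒x-y≈0 (p≗q x)))) α ⟩
    0#                             ∎)

  -- Only exponents occurring in the list can have a nonzero coefficient, so a finite search
  -- decides.
  zero-or-coeff : ∀ {k} (p : Poly k) → p ≈ₚ [] ⊎ ∃ λ α → ¬ coeff p α ≈ 0#
  zero-or-coeff p with any? (λ (_ , α) → ¬? (coeff p α ≟ 0#)) p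
  ... | yes any = inj₂ (_ , proj₂ (Any.satisfied any))
  ... | no ¬any = inj₁ λ β → stable λ c≉0 → ¬any (Any.map (λ { ≡.refl → c≉0 }) (occurs p β c≉0))
    where
    occurs : ∀ p β → ¬ coeff p β ≈ 0# → Any (λ (_ , α) → α ≡ β) p
    occurs []            β c≉0 = contradiction refl c≉0
    occurs ((a , α) ∷ p) β c≉0 with α ≟ᵛ β
    ... | yes α≡β = here α≡β
    ... | no  α≢β = there (occurs p β c≉0)

  univariate : Poly 1 → Carrier → Carrier
  univariate p t = eval p (λ _ → t)

  -- The top term is removed by prepending its negative to the list, which leaves a formal
  -- polynomial to recurse on.
  Deg<-univariate : ∀ D (p : Poly 1) → (∀ m → D ℕ.≤ m → coeff p (m ∷ []) ≈ 0#) → Deg< D (univariate p)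
  Lead-univariate : ∀ d (p : Poly 1) → (∀ m → d ℕ.< m → coeff p (m ∷ []) ≈ 0#) → Lead d (coeff p (d ∷ [])) (univariate p)
  Deg<-univariate zero    p z = vanishing λ t → eval-zero {p = p} (λ { (m ∷ []) → z m z≤n }) _
  Deg<-univariate (suc d) p z = Lead⇒Deg< (Lead-univariate d p z)
  Lead-univariate d p z = lead (Deg<-cong
    (λ t → solve 3 (λ c x e → :- c :* (x :* con (+ 1)) :+ e := e :- c :* x) refl c (t ^ d) (univariate p t))
    (Deg<-univariate d ((- c , d ∷ []) ∷ p) vanishes))
    where
    c = coeff p (d ∷ [])
    vanishes : ∀ m → d ℕ.≤ m → coeff ((- c , d ∷ []) ∷ p) (m ∷ []) ≈ 0#
    vanishes m d≤m with d ℕₚ.≟ m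
    ... | yes ≡.refl = trans (reflexive (coeff-here (- c) (d ∷ []) p)) (-‿inverseˡ c)
    ... | no  d≢m    = trans (reflexive (coeff-there {α = d ∷ []} (- c) p (λ eq → d≢m (Vecₚ.∷-injectiveˡ eq))))
                             (z m (ℕₚ.≤∧≢⇒< d≤m d≢m))

-- Functions of a point that are polynomial on lines.

module RegularFunctions (K : CharacteristicZeroField) where
  open CharacteristicZeroField K
  open FieldProperties K
  open PolynomialFunctions K
  open Evaluation K
  open IntegerCoefficients commutativeRing using (solve; _:=_; _:+_; _:*_; _:-_; :-_; con)
  open Polynomials commutativeRing
  open Relation.Binary.Reasoning.Setoid setoid

  set : ∀ {k} → Fin k → Carrier → Point k → Point k
  set i t x l = if does (l Finₚ.≟ i) then t else x l

  set-cong : ∀ {k} i {s t} {x y : Point k} → s ≈ t → (∀ l → x l ≈ y l) → ∀ l → set i s x l ≈ set i t y l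
  set-cong i s≈t x≗y l with l Finₚ.≟ i
  ... | yes _ = s≈t
  ... | no  _ = x≗y l

  set-same : ∀ {k} i (x : Point k) l → set i (x i) x l ≈ x l
  set-same i x l with l Finₚ.≟ i
  ... | yes ≡.refl = refl
  ... | no  _      = refl

  set-≢ : ∀ {k} {i j : Fin k} t x → i ≢ j → set j t x i ≡ x i
  set-≢ {i = i} {j} t x i≢j with i Finₚ.≟ j
  ... | yes i≡j = contradiction i≡j i≢j
  ... | no  _   = ≡.refl

  set-map : ∀ {k} (f : Carrier → Carrier) i t (x : Point k) l → f (set i t x l) ≡ set i (f t) (f ∘ x) l
  set-map f i t x l with l Finₚ.≟ i
  ... | yes _ = ≡.refl
  ... | no  _ = ≡.refl

  -- Setting coordinate `i` to `1#` deletes its power from the monomial, so the first factor is the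
  -- coefficient of the power of `t`.
  mono-set : ∀ {k} i t (x : Point k) α → mono (set i t x) α ≈ mono (set i 1# x) α * t ^ lookup α i
  mono-set zero    t x (a ∷ α) = trans (*-comm _ _) (*-congʳ (sym (trans (*-congʳ (1^ a)) (*-identityˡ _))))
  mono-set (suc i) t x (a ∷ α) = trans (*-congˡ (mono-set i t (x ∘ suc) α)) (sym (*-assoc _ _ _))

  -- The class in which the coefficients of `Q` with respect to one variable live. Being polynomial
  -- on each line, with a degree that may vary with the line, suffices to exclude zero divisors.
  record Regular {k} (c : Point k → Carrier) : Set where
    field
      congruent : ∀ {x y} → (∀ i → x i ≈ y i) → c x ≈ c y
      onLines   : ∀ (u v : Point k) → ∃ λ d → Deg< d (λ t → c (λ i → u i + t * v i))
  open Regular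

  module _ {k : ℕ} where

    regular-const : ∀ a → Regular {k} (λ _ → a)
    regular-const a = record { congruent = λ _ → refl ; onLines = λ _ _ → 1 , Deg<-const a }

    regular-coordinate : ∀ i → Regular {k} (λ x → x i)
    regular-coordinate i = record
      { congruent = λ x≗y → x≗y i
      ; onLines   = λ u v → 2 , Deg<-cong
          (λ t → solve 3 (λ u v t → v :* (t :* con (+ 1)) :+ u := u :+ t :* v) refl (u i) (v i) t)
          (Deg<-+ (Deg<-monomial 1 (v i)) (Deg<-suc (Deg<-const (u i))))
      }

    regular-+ : ∀ {b c : Point k → Carrier} → Regular b → Regular c → Regular (λ x → b x + c x)
    regular-+ rb rc = record
      { congruent = λ x≗y → +-cong (congruent rb x≗y) (congruent rc x≗y)
      ; onLines   = λ u v → let (d , p) = onLines rb u v ; (e , q) = onLines rc u v in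
          d ℕ.+ e , Deg<-+ (Deg<-≤ (ℕₚ.m≤m+n d e) p) (Deg<-≤ (ℕₚ.m≤n+m e d) q)
      }

    regular-* : ∀ {b c : Point k → Carrier} → Regular b → Regular c → Regular (λ x → b x * c x)
    regular-* rb rc = record
      { congruent = λ x≗y → *-cong (congruent rb x≗y) (congruent rc x≗y)
      ; onLines   = λ u v → let (d , p) = onLines rb u v ; (e , q) = onLines rc u v in
          d ℕ.+ e , Deg<-* p (Deg<-suc q)
      }

    regular-minus : ∀ {b c : Point k → Carrier} → Regular b → Regular c → Regular (λ x → b x - c x)
    regular-minus rb rc = regular-cong (λ x → solve 2 (λ b c → b :+ :- con (+ 1) :* c := b :- c) refl _ _)
      (regular-+ rb (regular-* (regular-const (- 1#)) rc))
      where
      regular-cong : ∀ {b c : Point k → Carrier} → (∀ x → b x ≈ c x) → Regular b → Regular c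
      regular-cong b≗c rb = record
        { congruent = λ x≗y → trans (sym (b≗c _)) (trans (congruent rb x≗y) (b≗c _))
        ; onLines   = λ u v → proj₁ (onLines rb u v) , Deg<-cong (λ _ → b≗c _) (proj₂ (onLines rb u v))
        }

    regular-^ : ∀ {c : Point k → Carrier} n → Regular c → Regular (λ x → c x ^ n)
    regular-^ zero    rc = regular-const 1#
    regular-^ (suc n) rc = regular-* rc (regular-^ n rc)

    regular-set : ∀ i t l → Regular {k} (λ x → set i t x l)
    regular-set i t l with l Finₚ.≟ i
    ... | yes _ = regular-const t
    ... | no  _ = regular-coordinate l

    regular-mono : ∀ {l} {y : Point k → Point l} α → (∀ i → Regular (λ x → y x i)) → Regular (λ x → mono (y x) α)
    regular-mono []      ry = regular-const 1#
    regular-mono (a ∷ α) ry = regular-* (regular-^ a (ry zero)) (regular-mono α (ry ∘ suc))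

    regular-eval : ∀ {l} (p : Poly l) {y : Point k → Point l} → (∀ i → Regular (λ x → y x i)) → Regular (λ x → eval p (y x))
    regular-eval []            ry = regular-const 0#
    regular-eval ((a , α) ∷ p) ry = regular-+ (regular-* (regular-const a) (regular-mono α ry)) (regular-eval p ry)

    -- Restriction to the line through y and x reduces this to one variable.
    regular-zero-product : ∀ {b c : Point k → Carrier} → Regular b → Regular c → (∀ x → b x * c x ≈ 0#) →
                           ∀ {y} → ¬ b y ≈ 0# → ∀ x → c x ≈ 0#
    regular-zero-product {b} {c} rb rc bc≈0 {y} by≉0 x = trans
      (congruent rc (λ i → solve 2 (λ x y → x := y :+ con (+ 1) :* (x :- y)) refl (x i) (y i)))
      (zero-product (proj₂ (onLines rb y v)) (proj₂ (onLines rc y v)) (λ t → bc≈0 (line t)) {0#}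
        (λ eq → by≉0 (trans (congruent rb (λ i → solve 2 (λ x y → y := y :+ con (+ 0) :* (x :- y)) refl (x i) (y i))) eq)) 1#)
      where
      v : Point k
      v i = x i - y i
      line : Carrier → Point k
      line t i = y i + t * v i

    -- `Deg<` in families: the bound is uniform in the point, and the coefficients are regular
    -- functions of it.
    data FamilyDeg< : ℕ → (Point k → Carrier → Carrier) → Set where
      vanishing : ∀ {f} → (∀ x t → f x t ≈ 0#) → FamilyDeg< 0 f
      top       : ∀ {d f} {c : Point k → Carrier} → Regular c →
                  FamilyDeg< d (λ x t → f x t - c x * t ^ d) → FamilyDeg< (suc d) f

    FamilyDeg<-at : ∀ {d f} → FamilyDeg< d f → ∀ x → Deg< d (f x)
    FamilyDeg<-at (vanishing z) x = vanishing (z x)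
    FamilyDeg<-at (top {c = c} _ r) x = top (c x) (FamilyDeg<-at r x)

    FamilyDeg<-cong : ∀ {d f g} → (∀ x t → f x t ≈ g x t) → FamilyDeg< d f → FamilyDeg< d g
    FamilyDeg<-cong f≗g (vanishing z) = vanishing λ x t → trans (sym (f≗g x t)) (z x t)
    FamilyDeg<-cong f≗g (top rc r)    = top rc (FamilyDeg<-cong (λ x t → +-congʳ (f≗g x t)) r)

    FamilyDeg<-+ : ∀ {d f g} → FamilyDeg< d f → FamilyDeg< d g → FamilyDeg< d (λ x t → f x t + g x t)
    FamilyDeg<-+ (vanishing y) (vanishing z) = vanishing λ x t → trans (+-cong (y x t) (z x t)) (+-identityʳ 0#)
    FamilyDeg<-+ {suc d} {f} {g} (top {c = b} rb p) (top {c = c} rc q) = top (regular-+ rb rc) (FamilyDeg<-cong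
      (λ x t → solve 5 (λ f g b c x → (f :- b :* x) :+ (g :- c :* x) := (f :+ g) :- (b :+ c) :* x)
        refl (f x t) (g x t) (b x) (c x) (t ^ d))
      (FamilyDeg<-+ p q))

    FamilyDeg<-raise : ∀ e {d f} → FamilyDeg< d f → FamilyDeg< (e ℕ.+ d) f
    FamilyDeg<-raise zero        r = r
    FamilyDeg<-raise (suc e) {d} r = top (regular-const 0#) (FamilyDeg<-cong
      (λ x t → solve 2 (λ f x → f := f :- con (+ 0) :* x) refl _ (t ^ (e ℕ.+ d))) (FamilyDeg<-raise e r))

    FamilyDeg<-monomial : ∀ d {c} → Regular c → FamilyDeg< (suc d) (λ x t → c x * t ^ d)
    FamilyDeg<-monomial d rc = top rc (FamilyDeg<-cong (λ x t → sym (-‿inverseʳ _)) (zeros d))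
      where
      zeros : ∀ d → FamilyDeg< d (λ _ _ → 0#)
      zeros zero    = vanishing λ _ _ → refl
      zeros (suc d) = FamilyDeg<-raise 1 (zeros d)

    FamilyDeg<-≡ : ∀ {d e f} → d ≡ e → FamilyDeg< d f → FamilyDeg< e f
    FamilyDeg<-≡ ≡.refl r = r

    eval-set : ∀ i (p : Poly k) → ∃ λ D → FamilyDeg< D (λ x t → eval p (set i t x))
    eval-set i []            = 0 , vanishing λ _ _ → refl
    eval-set i ((a , α) ∷ p) with eval-set i p
    ... | D , r = D ℕ.+ suc (lookup α i) , FamilyDeg<-+
      (FamilyDeg<-raise D (FamilyDeg<-cong
        (λ x t → trans (*-assoc _ _ _) (*-congˡ (sym (mono-set i t x α))))
        (FamilyDeg<-monomial (lookup α i) (regular-* (regular-const a) (regular-mono α (regular-set i 1#))))))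
      (FamilyDeg<-≡ (ℕₚ.+-comm (suc (lookup α i)) D) (FamilyDeg<-raise (suc (lookup α i)) r))

-- From the functional equation to a power and a monomial.

module Commuting (K : CharacteristicZeroField) where
  open CharacteristicZeroField K
  open FieldProperties K
  open PolynomialFunctions K
  open Evaluation K
  open RegularFunctions K
  open Regular
  open IntegerCoefficients commutativeRing using (solve; _:=_; _:+_; _:*_; _:-_; :-_; con)
  open Polynomials commutativeRing
  open Relation.Binary.Reasoning.Setoid setoid

  Independent : ∀ {k} → Poly k → Fin k → Set
  Independent Q i = ∀ x t → eval Q (set i t x) ≈ eval Q x

  record Leading {k} (Q : Poly k) (i : Fin k) : Set where
    field
      degree      : ℕ
      positive    : 1 ℕ.≤ degree
      coefficient : Point k → Carrier
      regular     : Regular coefficient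
      leads       : ∀ x → Lead degree (coefficient x) (λ t → eval Q (set i t x))
      base        : Point k
      base≉0      : ¬ coefficient base ≈ 0#

  -- Whether a regular coefficient vanishes identically is not decided, hence the double negation.
  -- If no leading term existed, each top coefficient would vanish everywhere and could be stripped,
  -- until `Q` is zero and so independent of the variable; a top term of degree 0 already means
  -- independence.
  dependent⇒Leading : ∀ {k} (Q : Poly k) i → ¬ Independent Q i → ¬ ¬ Leading Q i
  dependent⇒Leading {k} Q i dep ¬lead = go (proj₂ (eval-set i Q))
    where
    go : ∀ {D} → FamilyDeg< D (λ x t → eval Q (set i t x)) → ⊥
    go (vanishing z) = dep λ x t → trans (z x t) (sym (trans (eval-cong Q (λ l → sym (set-same i x l))) (z x (x i))))
    go {suc d} (top {c = c} rc r) = go (FamilyDeg<-cong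
      (λ x t → trans (+-congˡ (-‿cong (trans (*-congʳ (c≈0 x)) (zeroˡ _)))) (solve 1 (λ e → e :- con (+ 0) := e) refl _)) r)
      where
      leads : ∀ x → Lead d (c x) (λ t → eval Q (set i t x))
      leads x = lead (FamilyDeg<-at r x)
      constant⇒independent : d ≡ 0 → Independent Q i
      constant⇒independent ≡.refl x t with remainder (leads x)
      ... | vanishing z = begin
        eval Q (set i t x)      ≈⟨ x-y≈0⇒x≈y _ _ (z t) ⟩
        c x * 1#                ≈⟨ x-y≈0⇒x≈y _ _ (z (x i)) ⟨
        eval Q (set i (x i) x)  ≈⟨ eval-cong Q (set-same i x) ⟩
        eval Q x                ∎
      c≈0 : ∀ x → c x ≈ 0#
      c≈0 x = stable λ cx≉0 → ¬lead record
        { degree = d ; positive = ℕₚ.n≢0⇒n>0 (dep ∘ constant⇒independent)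
        ; coefficient = c ; regular = rc ; leads = leads ; base = x ; base≉0 = cx≉0 }

  -- Coordinates are changed one at a time, the tail before the head. The function is arbitrary so
  -- that the recursion applies to `f` with its first argument fixed.
  independent-agree : ∀ {k} {f : Point k → Carrier} → (∀ {x y} → (∀ i → x i ≈ y i) → f x ≈ f y) →
    ∀ {x y} → (∀ i → x i ≈ y i ⊎ (∀ z t → f (set i t z) ≈ f z)) → f x ≈ f y
  independent-agree {zero}  f-cong agree = f-cong λ ()
  independent-agree {suc k} {f} f-cong {x} {y} agree = begin
    f x                    ≈⟨ f-cong (λ { zero → refl ; (suc i) → refl }) ⟩
    f (x zero ∷ᵖ x ∘ suc)  ≈⟨ independent-agree (λ z≗w → f-cong (λ { zero → refl ; (suc i) → z≗w i })) tail-agree ⟩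
    f (x zero ∷ᵖ y ∘ suc)  ≈⟨ change-head (agree zero) ⟩
    f y                    ∎
    where
    tail-agree : ∀ i → x (suc i) ≈ y (suc i) ⊎ (∀ z t → f (x zero ∷ᵖ set i t z) ≈ f (x zero ∷ᵖ z))
    tail-agree i with agree (suc i)
    ... | inj₁ eq    = inj₁ eq
    ... | inj₂ indep = inj₂ λ z t → trans (f-cong λ { zero → refl ; (suc l) → refl }) (indep (x zero ∷ᵖ z) t)
    change-head : x zero ≈ y zero ⊎ (∀ z t → f (set zero t z) ≈ f z) → f (x zero ∷ᵖ y ∘ suc) ≈ f y
    change-head (inj₁ eq)    = f-cong λ { zero → eq ; (suc i) → refl }
    change-head (inj₂ indep) = trans (f-cong λ { zero → refl ; (suc i) → refl }) (indep y (x zero))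

  independent⇒single : ∀ {k} (Q : Poly k) i → (∀ j → j ≢ i → Independent Q j) → InSingleVariable Q i
  independent⇒single {k} Q i indep = Q ⟦ δ ⟧ , eval-injective {p = Q} {Q ⟦ δ ⟧ ∘ₚ X i} λ x → begin
    eval Q x                                            ≈⟨ independent-agree (eval-cong Q) (agree x) ⟩
    eval Q (λ l → eval (δ l) (λ _ → eval (X i) x))      ≈⟨ eval-⟦⟧ Q δ _ ⟨
    eval (Q ⟦ δ ⟧) (λ _ → eval (X i) x)                 ≈⟨ eval-⟦⟧ (Q ⟦ δ ⟧) (λ _ → X i) x ⟨
    eval (Q ⟦ δ ⟧ ∘ₚ X i) x                             ∎
    where
    δ : Fin k → Poly 1
    -- All other variables are replaced by the zero polynomial `[]`; their values do not matter.
    δ l = if does (l Finₚ.≟ i) then X zero else []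
    agree : ∀ x l → x l ≈ eval (δ l) (λ _ → eval (X i) x) ⊎ Independent Q l
    agree x l with l Finₚ.≟ i
    ... | yes ≡.refl = inj₁ (sym (trans (eval-X {1} zero (λ _ → eval (X i) x)) (eval-X i x)))
    ... | no  l≢i    = inj₂ (indep l l≢i)

  dilate : ∀ {k} → Fin k → Carrier → Poly k → Poly k
  dilate i c = reweight λ α → c ^ lookup α i

  eval-dilate : ∀ {k} i c (p : Poly k) x → eval (dilate i c p) x ≈ eval p (set i (c * x i) x)
  eval-dilate i c []            x = refl
  eval-dilate i c ((a , α) ∷ p) x = +-cong (begin
    c ^ e * a * mono x α                       ≈⟨ *-congˡ (trans (mono-cong (λ l → sym (set-same i x l)) α) (mono-set i (x i) x α)) ⟩
    c ^ e * a * (mono (set i 1# x) α * x i ^ e) ≈⟨ solve 4 (λ c a m u → c :* a :* (m :* u) := a :* (m :* (c :* u))) refl _ a _ _ ⟩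
    a * (mono (set i 1# x) α * (c ^ e * x i ^ e)) ≈⟨ *-congˡ (*-congˡ (^-distrib-* c (x i) e)) ⟨
    a * (mono (set i 1# x) α * (c * x i) ^ e)  ≈⟨ *-congˡ (mono-set i (c * x i) x α) ⟨
    a * mono (set i (c * x i) x) α             ∎) (eval-dilate i c p x)
    where e = lookup α i

  -- Doubling xᵢ multiplies `Q` by 2ᵖ but the coefficient at `α` by 2 to the power αᵢ; comparing
  -- coefficients forces the two powers of 2 to agree.
  homogeneous-exponent : ∀ {k} (Q : Poly k) i p {A : Point k → Carrier} →
    (∀ x t → eval Q (set i t x) ≈ A x * t ^ p) → ∀ {α} → ¬ coeff Q α ≈ 0# → lookup α i ≡ p
  homogeneous-exponent Q i p {A} hom {α} c≉0 = exponent-unique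
    where
    dilated : dilate i two Q ≈ₚ reweight (λ _ → two ^ p) Q
    dilated = eval-injective {p = dilate i two Q} {reweight (λ _ → two ^ p) Q} λ x → begin
      eval (dilate i two Q) x             ≈⟨ eval-dilate i two Q x ⟩
      eval Q (set i (two * x i) x)        ≈⟨ hom x (two * x i) ⟩
      A x * (two * x i) ^ p               ≈⟨ *-congˡ (^-distrib-* two (x i) p) ⟩
      A x * (two ^ p * x i ^ p)           ≈⟨ solve 3 (λ a b c → a :* (b :* c) := b :* (a :* c)) refl _ _ _ ⟩
      two ^ p * (A x * x i ^ p)           ≈⟨ *-congˡ (hom x (x i)) ⟨
      two ^ p * eval Q (set i (x i) x)    ≈⟨ *-congˡ (eval-cong Q (set-same i x)) ⟩
      two ^ p * eval Q x                  ≈⟨ eval-reweight-const (two ^ p) Q x ⟨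
      eval (reweight (λ _ → two ^ p) Q) x ∎
    powers-agree : ¬ two ^ lookup α i ≈ two ^ p → coeff Q α ≈ 0#
    powers-agree ≉ = *-cancel-0 (λ eq → ≉ (x-y≈0⇒x≈y _ _ eq)) (begin
      (two ^ lookup α i - two ^ p) * coeff Q α            ≈⟨ solve 3 (λ a b c → (a :- b) :* c := a :* c :- b :* c) refl _ _ _ ⟩
      two ^ lookup α i * coeff Q α - two ^ p * coeff Q α  ≈⟨ x≈y⇒x-y≈0 (trans (sym (coeff-reweight _ Q α)) (trans (dilated α) (coeff-reweight _ Q α))) ⟩
      0#                                                  ∎)
    exponent-unique : lookup α i ≡ p
    exponent-unique with ℕₚ.<-cmp (lookup α i) p
    ... | tri< < _ _ = contradiction (powers-agree (two^-injective-< <)) c≉0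
    ... | tri≈ _ ≡ _ = ≡
    ... | tri> _ _ > = contradiction (powers-agree (two^-injective-< > ∘ sym)) c≉0

  -- n = m + 2.
  module _ (m : ℕ) (P low : Carrier → Carrier)
           (P-cong : ∀ {s t} → s ≈ t → P s ≈ P t)
           (P≈ : ∀ t → P t ≈ t ^ suc (suc m) + low t)
           (low-degree : Deg< (suc m) low) where

    private
      n : ℕ
      n = suc (suc m)

    Lead-P : Lead n 1# P
    Lead-P = Lead-cong refl (λ t → sym (trans (P≈ t) (+-congʳ (sym (*-identityˡ _)))))
      (Lead-+-Deg< (Lead-monomial n 1#) (Deg<-suc low-degree))

    -- Comparing the coefficients of t ^ ((m + 1) p + r) shows that e x has no term of degree r.
    descent : ∀ {S : Set} (F : S → S) {p} → 1 ℕ.≤ p → (b e ρ : S → Carrier → Carrier) (β : S → Carrier) →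
      (∀ x → Lead p (β x) (b x)) → (∀ x → ¬ β x ≈ 0#) → (∀ x → Deg< p (e x)) → (∀ x → Deg< (suc (m ℕ.* p)) (ρ x)) →
      (∀ x t → e (F x) (P t) ≈ (b x t + e x t) ^ n - b x t ^ n + ρ x t) → ∀ x t → e x t ≈ 0#
    descent {S} F {p} 1≤p b e ρ β lb β≉0 de dρ functional = go p ℕₚ.≤-refl de
      where
      lower : ∀ {r} → r ℕ.< p → ∀ {x} → (∀ x → Deg< (suc r) (e x)) → Deg< (suc r) (e x) → Deg< r (e x)
      lower {r} r<p {x} des (top δ rem) = Lead-0⇒Deg< (lead rem) δ≈0
        where
        composed : Deg< (suc (r ℕ.* n)) (λ t → e (F x) (P t))
        composed = Deg<-∘ (des (F x)) (Lead⇒Deg< Lead-P)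
        -- The degree of n bⁿ⁻¹ e. The left side has degree at most r n = (m + 1) r + r and `ρ` at
        -- most m p, both below this.
        N = suc m ℕ.* p ℕ.+ r
        rn<N : r ℕ.* n ℕ.< N
        rn<N = ≡.subst (ℕ._< N) (≡.trans (ℕₚ.+-comm (suc m ℕ.* r) r) (≡.cong (r ℕ.+_) (ℕₚ.*-comm (suc m) r)) ⟨ ≡.trans ⟩ ≡.sym (ℕₚ.*-suc r (suc m)))
          (ℕₚ.+-monoˡ-< r (ℕₚ.*-monoʳ-< (suc m) r<p))
        mp<N : m ℕ.* p ℕ.< N
        mp<N = ℕₚ.<-≤-trans (ℕₚ.+-monoˡ-≤ (m ℕ.* p) 1≤p) (ℕₚ.m≤m+n _ r)
        leading : Lead N (n ×ᴷ 1# * (β x ^ suc m * δ)) (λ t → e (F x) (P t))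
        leading = Lead-cong refl (λ t → sym (functional x t))
          (Lead-+-Deg< (Lead-power-difference (suc m) r<p (lb x) (lead {c = δ} rem)) (Deg<-≤ mp<N (dρ x)))
        δ≈0 : δ ≈ 0#
        δ≈0 = *-cancel-0 (^-≉0 (suc m) (β≉0 x)) (*-cancel-0 (char0 (suc m)) (Lead-Deg<⇒0 leading composed rn<N))
      -- The bound is lowered for all `x` together, because the left side at `x` involves `e (F x)`.
      go : ∀ r → r ℕ.≤ p → (∀ x → Deg< r (e x)) → ∀ x t → e x t ≈ 0#
      go zero    _   des x t with des x
      ... | vanishing z = z t
      go (suc r) r<p des = go r (ℕₚ.<⇒≤ r<p) λ x → lower r<p des (des x)

    module _ {k : ℕ} (Q : Poly k) (commute : ∀ x → P (eval Q x) ≈ eval Q (P ∘ x)) where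

      module _ {i : Fin k} (L : Leading Q i) where
        open Leading L renaming (degree to p; coefficient to A; regular to regular-A; leads to Lead-Q)

        q : Point k → Carrier → Carrier
        q x t = eval Q (set i t x)

        regular-q : ∀ t → Regular (λ x → q x t)
        regular-q t = regular-eval Q (regular-set i t)

        q-P : ∀ x t → q (P ∘ x) (P t) ≈ P (q x t)
        q-P x t = trans (eval-cong Q (λ l → reflexive (≡.sym (set-map P i t x l)))) (sym (commute (set i t x)))

        A-P : ∀ x → A (P ∘ x) ≈ A x ^ n
        A-P x = begin
          A (P ∘ x)           ≈⟨ trans (*-congˡ (1^ p)) (*-identityʳ _) ⟨
          A (P ∘ x) * 1# ^ p  ≈⟨ Lead-unique (Lead-≡ (ℕₚ.*-comm p n) (Lead-∘ (s≤s z≤n) (Lead-Q (P ∘ x)) Lead-P))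
                                   (Lead-cong refl (λ t → sym (q-P x t)) (Lead-∘ positive Lead-P (Lead-Q x))) ⟩
          1# * A x ^ n        ≈⟨ *-identityˡ _ ⟩
          A x ^ n             ∎

        A-P-≉0 : ∀ x → ¬ A x ≈ 0# → ¬ A (P ∘ x) ≈ 0#
        A-P-≉0 x Ax≉0 eq = ^-≉0 n Ax≉0 (trans (sym (A-P x)) eq)

        -- `descent` with b = A x · q y and b + e = A y · q x: both have leading coefficient A x · A
        -- y, so e has degree below p. The index set carries the proofs of A ≠ 0, which `A-P`
        -- transports along `P`.
        generically-proportional : ∀ x y → ¬ A x ≈ 0# → ¬ A y ≈ 0# → ∀ t → A y * q x t - A x * q y t ≈ 0#
        generically-proportional x y Ax≉0 Ay≉0 = descent
          {S = ∃₂ λ x y → ¬ A x ≈ 0# × ¬ A y ≈ 0#}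
          (λ (x , y , a , b) → P ∘ x , P ∘ y , A-P-≉0 x a , A-P-≉0 y b) positive
          (λ (x , y , _) t → A x * q y t)
          (λ (x , y , _) t → A y * q x t - A x * q y t)
          (λ (x , y , _) t → A y ^ n * low (q x t) - A x ^ n * low (q y t))
          (λ (x , y , _) → A x * A y)
          (λ (x , y , _) → Lead-scale (A x) (Lead-Q y))
          (λ (x , y , a , b) → *-≉0 a b)
          (λ (x , y , _) → Deg<-cong
            (λ t → solve 5 (λ a b q s u → b :* (q :- a :* u) :- a :* (s :- b :* u) := b :* q :- a :* s) refl
              (A x) (A y) (q x t) (q y t) (t ^ p))
            (Deg<-minus (Deg<-scale (A y) (remainder (Lead-Q x))) (Deg<-scale (A x) (remainder (Lead-Q y)))))
          (λ (x , y , _) → Deg<-minus (Deg<-scale _ (Deg<-∘ low-degree (Lead⇒Deg< (Lead-Q x))))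
                                      (Deg<-scale _ (Deg<-∘ low-degree (Lead⇒Deg< (Lead-Q y)))))
          (λ (x , y , _) t → begin
            A (P ∘ y) * q (P ∘ x) (P t) - A (P ∘ x) * q (P ∘ y) (P t)
              ≈⟨ +-cong (*-cong (A-P y) (trans (q-P x t) (P≈ _))) (-‿cong (*-cong (A-P x) (trans (q-P y t) (P≈ _)))) ⟩
            A y ^ n * (q x t ^ n + low (q x t)) - A x ^ n * (q y t ^ n + low (q y t))
              ≈⟨ solve 6 (λ a b q s l k → b :* (q :+ l) :- a :* (s :+ k) := b :* q :- a :* s :+ (b :* l :- a :* k)) refl _ _ _ _ _ _ ⟩
            A y ^ n * q x t ^ n - A x ^ n * q y t ^ n + (A y ^ n * low (q x t) - A x ^ n * low (q y t))
              ≈⟨ +-congʳ (+-cong (trans (sym (^-distrib-* _ _ n)) (^-congˡ n (solve 2 (λ u v → u := v :+ (u :- v)) refl _ _)))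
                                 (-‿cong (sym (^-distrib-* _ _ n)))) ⟩
            (A x * q y t + (A y * q x t - A x * q y t)) ^ n - (A x * q y t) ^ n + (A y ^ n * low (q x t) - A x ^ n * low (q y t)) ∎)
          (x , y , Ax≉0 , Ay≉0)

        -- After multiplication by A x the difference vanishes at every x, trivially where A x = 0.
        -- As A is not zero at `base`, the factor cancels among regular functions.
        proportional : ∀ x t → A base * q x t ≈ A x * q base t
        proportional x t = x-y≈0⇒x≈y _ _ (regular-zero-product regular-A
          (regular-minus (regular-* (regular-const (A base)) (regular-q t)) (regular-* regular-A (regular-const (q base t))))
          (λ x → zero-off-A x (A x ≟ 0#)) base≉0 x)
          where
          zero-off-A : ∀ x → Dec (A x ≈ 0#) → A x * (A base * q x t - A x * q base t) ≈ 0#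
          zero-off-A x (yes eq) = trans (*-congʳ eq) (zeroˡ _)
          zero-off-A x (no ≉0)  = trans (*-congˡ (generically-proportional x base ≉0 base≉0 t)) (zeroʳ _)

        -- When `P` is a pure power, A x tᵖ satisfies the same functional equation as `q x t`. So
        -- `descent` with zero `ρ` kills the difference where A x ≠ 0, and A is cancelled as before.
        homogeneous : (∀ t → low t ≈ 0#) → ∀ x t → q x t ≈ A x * t ^ p
        homogeneous low≈0 x t = x-y≈0⇒x≈y _ _ (regular-zero-product regular-A
          (regular-minus (regular-q t) (regular-* regular-A (regular-const (t ^ p))))
          (λ x → zero-off-A x (A x ≟ 0#)) base≉0 x)
          where
          P-power : ∀ s → P s ≈ s ^ n
          P-power s = trans (P≈ s) (trans (+-congˡ (low≈0 s)) (+-identityʳ _))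
          generically : ∀ x → ¬ A x ≈ 0# → ∀ t → q x t - A x * t ^ p ≈ 0#
          generically x Ax≉0 = descent {S = ∃ λ x → ¬ A x ≈ 0#}
            (λ (x , a) → P ∘ x , A-P-≉0 x a) positive
            (λ (x , _) t → A x * t ^ p) (λ (x , _) t → q x t - A x * t ^ p) (λ _ _ → 0#) (λ (x , _) → A x)
            (λ (x , _) → Lead-monomial p (A x)) proj₂ (λ (x , _) → remainder (Lead-Q x)) (λ _ → Deg<-zero _ (λ _ → refl))
            (λ (x , _) t → begin
              q (P ∘ x) (P t) - A (P ∘ x) * P t ^ p
                ≈⟨ +-cong (trans (q-P x t) (P-power _)) (-‿cong (*-cong (A-P x) (^-congˡ p (P-power t)))) ⟩
              q x t ^ n - A x ^ n * (t ^ n) ^ p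
                ≈⟨ +-congˡ (-‿cong (*-congˡ (trans (^-assocʳ t n p) (trans (^-congʳ t (ℕₚ.*-comm n p)) (sym (^-assocʳ t p n)))))) ⟩
              q x t ^ n - A x ^ n * (t ^ p) ^ n
                ≈⟨ +-cong (^-congˡ n (solve 2 (λ u v → u := v :+ (u :- v)) refl _ _)) (-‿cong (sym (^-distrib-* _ _ n))) ⟩
              (A x * t ^ p + (q x t - A x * t ^ p)) ^ n - (A x * t ^ p) ^ n
                ≈⟨ +-identityʳ _ ⟨
              (A x * t ^ p + (q x t - A x * t ^ p)) ^ n - (A x * t ^ p) ^ n + 0# ∎)
            (x , Ax≉0)
          zero-off-A : ∀ x → Dec (A x ≈ 0#) → A x * (q x t - A x * t ^ p) ≈ 0#
          zero-off-A x (yes eq) = trans (*-congʳ eq) (zeroˡ _)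
          zero-off-A x (no ≉0)  = trans (*-congˡ (generically x ≉0 t)) (zeroʳ _)

        -- With Q = A · g(xᵢ) and A nonconstant along h, P(h s) g(z) ^ n is a multiple of h s ^ n.
        power-map : ∀ {j} → i ≢ j → Leading Q j → ∀ t → low t ≈ 0#
        power-map {j} i≢j M w = *-cancel-0 aγⁿ≉0 (begin
          a * γ ^ n * low w                            ≈⟨ solve 2 (λ u l → l := con (+ 0) :* u :+ l) refl (w ^ n) _ ⟩
          0# * w ^ n + a * γ ^ n * low w               ≈⟨ +-congʳ (*-congʳ (Lead-0 Lead-W W≈0)) ⟨
          (a * γ ^ n - v) * w ^ n + a * γ ^ n * low w  ≈⟨ W≈0 w ⟩
          0#                                           ∎)
          where
          module M = Leading M
          z : Point k
          z = M.base
          a γ g v : Carrier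
          a = A base
          γ = q base (z i)
          g = q base (P (z i))
          v = a ^ n * g
          x : Carrier → Point k
          x s = set j s z
          -- Moving coordinate `j` through the base point of `M` makes this a polynomial of positive
          -- degree in `s` with nonzero leading coefficient.
          h : Carrier → Carrier
          h s = eval Q (x s)
          x-i : ∀ s l → set i (z i) (x s) l ≈ x s l
          x-i s l = trans (set-cong i {x = x s} (reflexive (≡.sym (set-≢ s z i≢j))) (λ _ → refl) l) (set-same i (x s) l)
          h-factors : ∀ s → a * h s ≈ A (x s) * γ
          h-factors s = trans (*-congˡ (eval-cong Q (λ l → sym (x-i s l)))) (proportional (x s) (z i))
          P-h-factors : ∀ s → a * P (h s) ≈ A (x s) ^ n * g
          P-h-factors s = begin
            a * P (h s)                   ≈⟨ *-congˡ (P-cong (eval-cong Q (λ l → sym (x-i s l)))) ⟩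
            a * P (q (x s) (z i))         ≈⟨ *-congˡ (q-P (x s) (z i)) ⟨
            a * q (P ∘ x s) (P (z i))     ≈⟨ proportional (P ∘ x s) (P (z i)) ⟩
            A (P ∘ x s) * g               ≈⟨ *-congʳ (A-P (x s)) ⟩
            A (x s) ^ n * g               ∎
          γ≉0 : ¬ γ ≈ 0#
          -- If `γ` were zero, `h-factors` would make `h` vanish identically.
          γ≉0 γ≈0 = M.base≉0 (Lead-0 (M.leads z)
            λ s → *-cancel-0 base≉0 (trans (h-factors s) (trans (*-congˡ γ≈0) (zeroʳ _))))
          aγⁿ≉0 : ¬ a * γ ^ n ≈ 0#
          aγⁿ≉0 = *-≉0 base≉0 (^-≉0 n γ≉0)
          -- By `W-h` this polynomial vanishes on the values of `h`, hence everywhere. Its leading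
          -- coefficient is then zero, and what remains is the multiple of `low`.
          W : Carrier → Carrier
          W w = (a * γ ^ n - v) * w ^ n + a * γ ^ n * low w
          Lead-W : Lead n (a * γ ^ n - v) W
          Lead-W = Lead-+-Deg< (Lead-monomial n _) (Deg<-scale _ (Deg<-suc low-degree))
          W-h : ∀ s → W (h s) ≈ 0#
          W-h s = begin
            (a * γ ^ n - v) * h s ^ n + a * γ ^ n * low (h s)
              ≈⟨ solve 4 (λ k v u l → (k :- v) :* u :+ k :* l := k :* (u :+ l) :- v :* u) refl (a * γ ^ n) v _ _ ⟩
            a * γ ^ n * (h s ^ n + low (h s)) - v * h s ^ n
              ≈⟨ +-cong (*-congˡ (sym (P≈ (h s)))) (-‿cong (solve 3 (λ a g u → a :* g :* u := a :* u :* g) refl (a ^ n) g _)) ⟩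
            a * γ ^ n * P (h s) - a ^ n * h s ^ n * g
              ≈⟨ +-cong (trans (solve 3 (λ a c p → a :* c :* p := a :* p :* c) refl a _ _) (*-congʳ (P-h-factors s)))
                        (-‿cong (*-congʳ (trans (sym (^-distrib-* a (h s) n)) (trans (^-congˡ n (h-factors s)) (^-distrib-* _ γ n))))) ⟩
            A (x s) ^ n * g * γ ^ n - A (x s) ^ n * γ ^ n * g
              ≈⟨ solve 3 (λ a g c → a :* g :* c :- a :* c :* g := con (+ 0)) refl _ g _ ⟩
            0# ∎
          W≈0 : ∀ w → W w ≈ 0#
          W≈0 = vanishing-on-image (Lead⇒Deg< Lead-W) M.positive M.base≉0 (M.leads z) W-h

      -- A variable on which `Q` does not depend is the homogeneous case of degree 0. Equality of
      -- exponents is decidable, which absorbs the double negation of `dependent⇒Leading`.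
      homogeneous-in : (∀ t → low t ≈ 0#) → ∀ i {α β} → ¬ coeff Q α ≈ 0# → ¬ coeff Q β ≈ 0# → lookup α i ≡ lookup β i
      homogeneous-in low≈0 i {α} {β} α≉0 β≉0 = decidable-stable (lookup α i ℕₚ.≟ lookup β i) λ α≢β →
        let independent⇒≡ : ¬ Independent Q i
            independent⇒≡ ind = α≢β (same 0 {λ x → eval Q x} λ x t → trans (ind x t) (sym (*-identityʳ _)))
        in dependent⇒Leading Q i independent⇒≡ λ L →
             α≢β (same (Leading.degree L) (homogeneous L low≈0))
        where
        same : ∀ p {A : Point k → Carrier} → (∀ x t → eval Q (set i t x) ≈ A x * t ^ p) → lookup α i ≡ lookup β i
        same p hom = ≡.trans (homogeneous-exponent Q i p hom α≉0) (≡.sym (homogeneous-exponent Q i p hom β≉0))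

      module _ (not-single : ∀ i → ¬ InSingleVariable Q i) where

        -- If `low` is nonzero somewhere, `power-map` forbids dependence on two variables.
        -- Dependence on one would then make `Q` a polynomial in it alone; dependence on none makes
        -- `Q` constant, which counts as a polynomial in `i₀`.
        power-form : Fin k → ∀ t → low t ≈ 0#
        power-form i₀ t = stable λ low≉0 →
          let independent : ∀ j → Independent Q j
              independent j x s = stable λ ≉ → dependent⇒Leading Q j (λ ind → ≉ (ind x s)) λ L →
                not-single j (independent⇒single Q j λ l l≢j y s → stable λ ≉ →
                  dependent⇒Leading Q l (λ ind → ≉ (ind y s)) λ M → low≉0 (power-map L (l≢j ∘ ≡.sym) M t))
          in not-single i₀ (independent⇒single Q i₀ λ j _ → independent j)

        monomial-form : Fin k → ∀ {α} → ¬ coeff Q α ≈ 0# → Q ≈ₚ monomial (coeff Q α) α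
        monomial-form i₀ {α} α≉0 β with α ≟ᵛ β
        ... | yes ≡.refl = sym (+-identityʳ _)
        ... | no  α≢β    = stable λ β≉0 → α≢β (lookup-injective λ i → homogeneous-in (power-form i₀) i α≉0 β≉0)
          where
          lookup-injective : ∀ {k} {α β : Vec ℕ k} → (∀ i → lookup α i ≡ lookup β i) → α ≡ β
          lookup-injective {α = []}    {[]}    eq = ≡.refl
          lookup-injective {α = a ∷ α} {b ∷ β} eq = ≡.cong₂ _∷_ (eq zero) (lookup-injective (eq ∘ suc))

-- The intermediate value theorem and real roots.

module RealAnalysis (ℝ : CompleteOrderedField) where
  open CompleteOrderedField ℝ using (_<_; _≤_; +-monoˡ-<; *-pos; supremum; invertible; 0≉1; isStrictTotalOrder)
  open CommutativeRing (CompleteOrderedField.commutativeRing ℝ) hiding (zero)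
  open Algebra.Definitions.RawSemiring (Semiring.rawSemiring semiring) using (_^_) renaming (_×_ to _×ᴿ_)
  private module < = IsStrictTotalOrder isStrictTotalOrder
  open < using (_≟_; compare)
  open IntegerCoefficients (CompleteOrderedField.commutativeRing ℝ) using (solve; _:=_; _:+_; _:*_; _:-_; :-_; con)
  open Relation.Binary.Reasoning.Setoid setoid

  <-resp : ∀ {w x y z} → w ≈ x → y ≈ z → w < y → x < z
  <-resp w≈x y≈z w<y = <.<-respˡ-≈ w≈x (<.<-respʳ-≈ y≈z w<y)

  pos-resp : ∀ {x y} → x ≈ y → 0# < x → 0# < y
  pos-resp = <.<-respʳ-≈

  pos≉0 : ∀ {x} → 0# < x → ¬ x ≈ 0#
  pos≉0 0<x x≈0 = <.irrefl (sym x≈0) 0<x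

  difference-pos : ∀ {x y} → x < y → 0# < y - x
  difference-pos {x} {y} x<y = <-resp (-‿inverseʳ x) refl (+-monoˡ-< (- x) x<y)

  pos-difference : ∀ {x y} → 0# < y - x → x < y
  pos-difference {x} {y} 0<y-x = <-resp (+-identityˡ x) (solve 2 (λ x y → y :- x :+ x := y) refl x y) (+-monoˡ-< x 0<y-x)

  neg-pos : ∀ {x} → x < 0# → 0# < - x
  neg-pos x<0 = pos-resp (+-identityˡ _) (difference-pos x<0)

  pos-neg : ∀ {x} → 0# < - x → x < 0#
  pos-neg 0<-x = pos-difference (pos-resp (sym (+-identityˡ _)) 0<-x)

  +-pos : ∀ {x y} → 0# < x → 0# < y → 0# < x + y
  +-pos {x} {y} 0<x 0<y = <.trans 0<y (<-resp (+-identityˡ y) refl (+-monoˡ-< y 0<x))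

  NonNegative : Carrier → Set
  NonNegative x = 0# < x ⊎ x ≈ 0#

  +-pos-nonneg : ∀ {x y} → 0# < x → NonNegative y → 0# < x + y
  +-pos-nonneg 0<x (inj₁ 0<y) = +-pos 0<x 0<y
  +-pos-nonneg 0<x (inj₂ y≈0) = pos-resp (sym (trans (+-congˡ y≈0) (+-identityʳ _))) 0<x

  *-nonneg-pos : ∀ {x y} → NonNegative x → 0# < y → NonNegative (x * y)
  *-nonneg-pos (inj₁ 0<x) 0<y = inj₁ (*-pos 0<x 0<y)
  *-nonneg-pos (inj₂ x≈0) 0<y = inj₂ (trans (*-congʳ x≈0) (zeroˡ _))

  square-pos : ∀ {x} → ¬ x ≈ 0# → 0# < x * x
  square-pos {x} x≉0 with compare x 0#
  ... | tri< x<0 _ _ = pos-resp (solve 1 (λ x → :- x :* :- x := x :* x) refl x) (*-pos (neg-pos x<0) (neg-pos x<0))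
  ... | tri≈ _ x≈0 _ = contradiction x≈0 x≉0
  ... | tri> _ _ 0<x = *-pos 0<x 0<x

  square-nonneg : ∀ x → NonNegative (x * x)
  square-nonneg x with x ≟ 0#
  ... | yes x≈0 = inj₂ (trans (*-congʳ x≈0) (zeroˡ x))
  ... | no  x≉0 = inj₁ (square-pos x≉0)

  1-pos : 0# < 1#
  1-pos = pos-resp (*-identityˡ 1#) (square-pos (λ 1≈0 → 0≉1 (sym 1≈0)))

  ×1-pos : ∀ n → 0# < suc n ×ᴿ 1#
  ×1-pos zero    = pos-resp (sym (+-identityʳ 1#)) 1-pos
  ×1-pos (suc n) = +-pos 1-pos (×1-pos n)

  ^-pos : ∀ {x} n → 0# < x → 0# < x ^ n
  ^-pos zero    0<x = 1-pos
  ^-pos (suc n) 0<x = *-pos 0<x (^-pos n 0<x)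

  pos-* : ∀ {x y} → 0# < x → 0# < x * y → 0# < y
  pos-* {x} {y} 0<x 0<xy with compare y 0#
  ... | tri< y<0 _ _ = contradiction (+-pos 0<xy (*-pos 0<x (neg-pos y<0)))
    (<.irrefl (sym (solve 2 (λ x y → x :* y :+ x :* :- y := con (+ 0)) refl x y)))
  ... | tri≈ _ y≈0 _ = contradiction (trans (*-congˡ y≈0) (zeroʳ x)) (pos≉0 0<xy)
  ... | tri> _ _ 0<y = 0<y

  neg-* : ∀ {x y} → x < 0# → 0# < x * y → y < 0#
  neg-* {x} {y} x<0 0<xy = pos-neg (pos-* (neg-pos x<0)
    (pos-resp (solve 2 (λ x y → x :* y := :- x :* :- y) refl x y) 0<xy))

  reciprocal : ∀ {x} → 0# < x → ∃ λ y → 0# < y × y * x ≈ 1#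
  reciprocal 0<x with invertible (pos≉0 0<x)
  ... | y , yx≈1 , xy≈1 = y , pos-* 0<x (pos-resp (sym xy≈1) 1-pos) , yx≈1

  half : ∀ {x} → 0# < x → ∃ λ y → 0# < y × y < x
  half {x} 0<x = let (h , 0<h , 2h≈1) = reciprocal (+-pos 1-pos 1-pos) in
    h * x , *-pos 0<h 0<x , pos-difference (pos-resp
      (trans (solve 2 (λ h x → h :* x := h :* (con (+ 1) :+ con (+ 1)) :* x :- h :* x) refl h x)
             (+-congʳ (trans (*-congʳ 2h≈1) (*-identityˡ x))))
      (*-pos 0<h 0<x))

  common-lower : ∀ {x y} → 0# < x → 0# < y → ∃ λ z → 0# < z × z < x × z < y
  common-lower {x} {y} 0<x 0<y with compare x y
  ... | tri< x<y _ _ = let (z , 0<z , z<x) = half 0<x in z , 0<z , z<x , <.trans z<x x<y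
  ... | tri≈ _ x≈y _ = let (z , 0<z , z<x) = half 0<x in z , 0<z , z<x , <-resp refl x≈y z<x
  ... | tri> _ _ y<x = let (z , 0<z , z<y) = half 0<y in z , 0<z , <.trans z<y y<x , z<y

  -- Squares stand in for absolute values.
  record Bounded (g : Carrier → Carrier) : Set where
    field
      bound     : Carrier
      bound-pos : 0# < bound
      bounds    : ∀ h → h * h < 1# → 0# < bound - g h * g h

  bounded-const : ∀ c → Bounded (λ _ → c)
  bounded-const c = record
    { bound = 1# + c * c ; bound-pos = +-pos-nonneg 1-pos (square-nonneg c)
    ; bounds = λ _ _ → pos-resp (solve 1 (λ x → con (+ 1) := con (+ 1) :+ x :- x) refl (c * c)) 1-pos }

  bounded-id : Bounded (λ h → h)
  bounded-id = record { bound = 1# ; bound-pos = 1-pos ; bounds = λ _ → difference-pos }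

  -- The bounds are doubled because (x + y)² + (x - y)² = 2 x² + 2 y².
  bounded-+ : ∀ {f g} → Bounded f → Bounded g → Bounded (λ h → f h + g h)
  bounded-+ {f} {g} bf bg = record
    { bound = (M + M) + (N + N) ; bound-pos = +-pos (+-pos F.bound-pos F.bound-pos) (+-pos G.bound-pos G.bound-pos)
    ; bounds = λ h h²<1 → pos-resp
        (solve 4 (λ M N x y → (M :- x :* x :+ (M :- x :* x)) :+ (N :- y :* y :+ (N :- y :* y)) :+ (x :- y) :* (x :- y) :=
                              (M :+ M) :+ (N :+ N) :- (x :+ y) :* (x :+ y)) refl M N (f h) (g h))
        (+-pos-nonneg (+-pos (+-pos (F.bounds h h²<1) (F.bounds h h²<1)) (+-pos (G.bounds h h²<1) (G.bounds h h²<1)))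
                      (square-nonneg _)) }
    where
    module F = Bounded bf
    module G = Bounded bg
    M = F.bound
    N = G.bound

  bounded-* : ∀ {f g} → Bounded f → Bounded g → Bounded (λ h → f h * g h)
  bounded-* {f} {g} bf bg = record
    { bound = M * N ; bound-pos = *-pos F.bound-pos G.bound-pos
    ; bounds = λ h h²<1 → pos-resp
        (solve 4 (λ M N x y → M :* (N :- y :* y) :+ y :* y :* (M :- x :* x) := M :* N :- x :* y :* (x :* y)) refl M N (f h) (g h))
        (+-pos-nonneg (*-pos F.bound-pos (G.bounds h h²<1)) (*-nonneg-pos (square-nonneg _) (F.bounds h h²<1))) }
    where
    module F = Bounded bf
    module G = Bounded bg
    M = F.bound
    N = G.bound

  -- A Lipschitz condition around each point takes the place of continuity: sums and products
  -- inherit it by algebra alone, and it covers all polynomial functions.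
  record Smooth (f : Carrier → Carrier) : Set where
    field
      congruent : ∀ {x y} → x ≈ y → f x ≈ f y
      expand    : ∀ s → ∃ λ g → Bounded g × (∀ h → f (s + h) ≈ f s + h * g h)

  smooth-const : ∀ c → Smooth (λ _ → c)
  smooth-const c = record
    { congruent = λ _ → refl
    ; expand = λ s → (λ _ → 0#) , bounded-const 0# , λ h → solve 2 (λ c h → c := c :+ h :* con (+ 0)) refl c h }

  smooth-id : Smooth (λ t → t)
  smooth-id = record
    { congruent = λ eq → eq
    ; expand = λ s → (λ _ → 1#) , bounded-const 1# , λ h → solve 2 (λ s h → s :+ h := s :+ h :* con (+ 1)) refl s h }

  smooth-+ : ∀ {f g} → Smooth f → Smooth g → Smooth (λ t → f t + g t)
  smooth-+ sf sg = record
    { congruent = λ eq → +-cong (F.congruent eq) (G.congruent eq)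
    ; expand = λ s → let (p , bp , ep) = F.expand s ; (q , bq , eq) = G.expand s in
        (λ h → p h + q h) , bounded-+ bp bq , λ h → trans (+-cong (ep h) (eq h))
          (solve 5 (λ f g h p q → (f :+ h :* p) :+ (g :+ h :* q) := (f :+ g) :+ h :* (p :+ q)) refl _ _ h (p h) (q h)) }
    where
    module F = Smooth sf
    module G = Smooth sg

  smooth-* : ∀ {f g} → Smooth f → Smooth g → Smooth (λ t → f t * g t)
  smooth-* {f} {g} sf sg = record
    { congruent = λ eq → *-cong (F.congruent eq) (G.congruent eq)
    ; expand = λ s → let (p , bp , ep) = F.expand s ; (q , bq , eq) = G.expand s in
        (λ h → (f s * q h + g s * p h) + h * (p h * q h)) ,
        bounded-+ (bounded-+ (bounded-* (bounded-const (f s)) bq) (bounded-* (bounded-const (g s)) bp))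
                  (bounded-* bounded-id (bounded-* bp bq)) ,
        λ h → trans (*-cong (ep h) (eq h))
          (solve 5 (λ f g h p q → (f :+ h :* p) :* (g :+ h :* q) := f :* g :+ h :* ((f :* q :+ g :* p) :+ h :* (p :* q))) refl
            (f s) (g s) h (p h) (q h)) }
    where
    module F = Smooth sf
    module G = Smooth sg

  smooth-cong : ∀ {f g} → (∀ t → f t ≈ g t) → Smooth f → Smooth g
  smooth-cong f≗g sf = record
    { congruent = λ eq → trans (sym (f≗g _)) (trans (F.congruent eq) (f≗g _))
    ; expand = λ s → let (p , bp , ep) = F.expand s in
        p , bp , λ h → trans (sym (f≗g _)) (trans (ep h) (+-congʳ (f≗g s))) }
    where module F = Smooth sf

  smooth-minus : ∀ {f g} → Smooth f → Smooth g → Smooth (λ t → f t - g t)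
  smooth-minus sf sg = smooth-cong (λ t → solve 2 (λ f g → f :+ :- con (+ 1) :* g := f :- g) refl _ _)
    (smooth-+ sf (smooth-* (smooth-const (- 1#)) sg))

  smooth-^ : ∀ {f} n → Smooth f → Smooth (λ t → f t ^ n)
  smooth-^ zero    sf = smooth-const 1#
  smooth-^ (suc n) sf = smooth-* sf (smooth-^ n sf)

  -- 2 η (η + h g) = (η + h g)² + (η² - (h g)²), so f keeps its sign where (h g)² < η².
  sign-locally-constant : ∀ {f} → Smooth f → ∀ s → ¬ f s ≈ 0# →
    ∃ λ δ → 0# < δ × δ < 1# × (∀ h → h * h < δ → 0# < f s * f (s + h))
  sign-locally-constant {f} sf s η≉0 =
    δ , *-pos 0<η² 0<k , pos-difference (pos-resp 1-δ (*-pos 0<k B.bound-pos)) , same-sign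
    where
    g = proj₁ (Smooth.expand sf s)
    module B = Bounded (proj₁ (proj₂ (Smooth.expand sf s)))
    f≈ = proj₂ (proj₂ (Smooth.expand sf s))
    η = f s
    M = B.bound
    0<η² = square-pos η≉0
    k = proj₁ (reciprocal (+-pos 0<η² B.bound-pos))
    0<k = proj₁ (proj₂ (reciprocal (+-pos 0<η² B.bound-pos)))
    k[η²+M]≈1 : k * (η * η + M) ≈ 1#
    k[η²+M]≈1 = proj₂ (proj₂ (reciprocal (+-pos 0<η² B.bound-pos)))
    -- This is η² / (η² + M). It is below 1, as the use of `bounds` requires, and η² - δ M = η² δ is
    -- still positive.
    δ = η * η * k
    1-δ : k * M ≈ 1# - δ
    1-δ = trans (solve 3 (λ k e M → k :* M := k :* (e :+ M) :- e :* k) refl k (η * η) M) (+-congʳ k[η²+M]≈1)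
    η²-δM : η * η * (η * η * k) ≈ η * η - δ * M
    η²-δM = trans (solve 3 (λ k e M → e :* (e :* k) := e :* (k :* (e :+ M)) :- e :* k :* M) refl k (η * η) M)
                  (+-congʳ (trans (*-congˡ k[η²+M]≈1) (*-identityʳ _)))
    same-sign : ∀ h → h * h < δ → 0# < η * f (s + h)
    same-sign h h²<δ = pos-* (+-pos 1-pos 1-pos) (pos-resp
      (trans (solve 5 (λ η δ M h g → (η :* η :- δ :* M) :+ δ :* (M :- g :* g) :+ g :* g :* (δ :- h :* h) :+ (η :+ h :* g) :* (η :+ h :* g) :=
                                     (con (+ 1) :+ con (+ 1)) :* (η :* (η :+ h :* g))) refl η δ M h (g h))
             (*-congˡ (*-congˡ (sym (f≈ h)))))
      (+-pos-nonneg (+-pos-nonneg (+-pos (pos-resp η²-δM (*-pos 0<η² (*-pos 0<η² 0<k)))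
                                         (*-pos (*-pos 0<η² 0<k) (B.bounds h (<.trans h²<δ δ<1))))
                                  (*-nonneg-pos (square-nonneg (g h)) (difference-pos h²<δ)))
                    (square-nonneg _)))
      where
      δ<1 : δ < 1#
      δ<1 = pos-difference (pos-resp 1-δ (*-pos 0<k B.bound-pos))

  -- The zero is the supremum of the points below `hi` where `f` is negative. If `f s` were
  -- negative, `f` would still be so slightly beyond `s`; if positive, `s - δ` would already be an
  -- upper bound.
  intermediate-value : ∀ {f} → Smooth f → ∀ {lo hi} → lo < hi → f lo < 0# → 0# < f hi → ∃ λ s → f s ≈ 0#
  intermediate-value {f} sf {lo} {hi} lo<hi flo<0 0<fhi = s , fs≈0
    where
    open Smooth sf
    S : Carrier → Set
    S x = x < hi × f x < 0#
    sup = supremum S (lo , lo<hi , flo<0) (hi , λ (x<hi , _) → inj₁ x<hi)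
    s = proj₁ sup
    upper : ∀ {x} → S x → x ≤ s
    upper = proj₁ (proj₂ sup)
    ¬<∧≤ : ∀ {x y} → x < y → ¬ y ≤ x
    ¬<∧≤ x<y (inj₁ y<x) = <.irrefl refl (<.trans x<y y<x)
    ¬<∧≤ x<y (inj₂ y≈x) = <.irrefl (sym y≈x) x<y
    s<hi : f s < 0# → s < hi
    s<hi fs<0 with proj₂ (proj₂ sup) {hi} (λ (x<hi , _) → inj₁ x<hi)
    ... | inj₁ s<hi = s<hi
    ... | inj₂ s≈hi = contradiction (<.trans 0<fhi (<-resp (congruent s≈hi) refl fs<0)) (<.irrefl refl)
    fs≈0 : f s ≈ 0#
    fs≈0 with compare (f s) 0#
    ... | tri≈ _ fs≈0 _ = fs≈0
    ... | tri< fs<0 fs≉0 _ = contradiction (upper (s+h<hi , neg-* fs<0 (same-sign h h²<δ))) (¬<∧≤ s<s+h)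
      where
      near = sign-locally-constant sf s fs≉0
      δ = proj₁ near
      0<δ = proj₁ (proj₂ near)
      δ<1 = proj₁ (proj₂ (proj₂ near))
      same-sign = proj₂ (proj₂ (proj₂ near))
      -- Below `hi - s` to stay in `S`, and below `δ`, which is less than 1, so that also h² < δ.
      small = common-lower 0<δ (difference-pos (s<hi fs<0))
      h = proj₁ small
      0<h = proj₁ (proj₂ small)
      h<δ = proj₁ (proj₂ (proj₂ small))
      h<hi-s = proj₂ (proj₂ (proj₂ small))
      s<s+h : s < s + h
      s<s+h = pos-difference (pos-resp (solve 2 (λ s h → h := s :+ h :- s) refl s h) 0<h)
      s+h<hi : s + h < hi
      s+h<hi = pos-difference (pos-resp (solve 3 (λ t s h → (t :- s) :- h := t :- (s :+ h)) refl hi s h) (difference-pos h<hi-s))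
      h²<δ : h * h < δ
      h²<δ = pos-difference (pos-resp (solve 2 (λ d h → (d :- h) :+ h :* (con (+ 1) :- h) := d :- h :* h) refl δ h)
        (+-pos (difference-pos h<δ) (*-pos 0<h (difference-pos (<.trans h<δ δ<1)))))
    ... | tri> _ fs≉0 0<fs = contradiction (proj₂ (proj₂ sup) lower-bound) (¬<∧≤ s-δ<s)
      where
      near = sign-locally-constant sf s fs≉0
      δ = proj₁ near
      0<δ = proj₁ (proj₂ near)
      δ<1 = proj₁ (proj₂ (proj₂ near))
      same-sign = proj₂ (proj₂ (proj₂ near))
      s-δ<s : s - δ < s
      s-δ<s = pos-difference (pos-resp (solve 2 (λ s d → d := s :- (s :- d)) refl s δ) 0<δ)
      lower-bound : ∀ {x} → S x → x ≤ s - δ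
      lower-bound {x} x∈S@(_ , fx<0) with compare x (s - δ)
      ... | tri< x<s-δ _ _ = inj₁ x<s-δ
      ... | tri≈ _ x≈s-δ _ = inj₂ x≈s-δ
      ... | tri> _ _ s-δ<x = contradiction (<.trans fx<0 (pos-* 0<fs (pos-resp (*-congˡ (congruent s+[x-s]≈x)) (same-sign (x - s) h²<δ))))
          (<.irrefl refl)
        where
        s+[x-s]≈x : s + (x - s) ≈ x
        s+[x-s]≈x = solve 2 (λ s x → s :+ (x :- s) := x) refl s x
        s-x≥0 : NonNegative (s - x)
        s-x≥0 with upper x∈S
        ... | inj₁ x<s = inj₁ (difference-pos x<s)
        ... | inj₂ x≈s = inj₂ (trans (+-congˡ (-‿cong x≈s)) (-‿inverseʳ s))
        δ-[s-x]>0 : 0# < δ - (s - x)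
        δ-[s-x]>0 = pos-resp (solve 3 (λ x s d → x :- (s :- d) := d :- (s :- x)) refl x s δ) (difference-pos s-δ<x)
        h²<δ : (x - s) * (x - s) < δ
        h²<δ = pos-difference (pos-resp
          (solve 3 (λ d s x → (d :- (s :- x)) :+ (s :- x) :* ((con (+ 1) :- d) :+ (d :- (s :- x))) := d :- (x :- s) :* (x :- s)) refl δ s x)
          (+-pos-nonneg δ-[s-x]>0 (*-nonneg-pos s-x≥0 (+-pos (difference-pos δ<1) δ-[s-x]>0))))

  antisymmetric-zero : ∀ {f} → Smooth f → ∀ {lo hi b} → lo < hi → f lo ≈ b → f hi ≈ - b → ∃ λ s → f s ≈ 0#
  antisymmetric-zero {f} sf {lo} {hi} {b} lo<hi flo≈b fhi≈-b with compare b 0#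
  ... | tri≈ _ b≈0 _ = lo , trans flo≈b b≈0
  ... | tri< b<0 _ _ = intermediate-value sf lo<hi (<-resp (sym flo≈b) refl b<0) (pos-resp (sym fhi≈-b) (neg-pos b<0))
  ... | tri> _ _ 0<b = let (s , -fs≈0) = intermediate-value (smooth-* (smooth-const (- 1#)) sf) lo<hi
                             (pos-neg (pos-resp (trans (sym flo≈b) (x≈--x (f lo))) 0<b))
                             (pos-resp (trans (solve 1 (λ b → b := :- con (+ 1) :* :- b) refl b) (*-congˡ (sym fhi≈-b))) 0<b)
    in s , trans (x≈--x (f s)) (trans (-‿cong -fs≈0) (solve 0 (:- con (+ 0) := con (+ 0)) refl))
    where
    x≈--x : ∀ x → x ≈ - (- 1# * x)
    x≈--x = solve 1 (λ x → x := :- (:- con (+ 1) :* x)) refl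

  -- The intermediate value theorem on the interval from 0 to 1 + c, whose right end has every
  -- positive power above c.
  root-pos : ∀ n {c} → 0# < c → ∃ λ y → y ^ suc n ≈ c
  root-pos n {c} 0<c = let (y , eq) = zero-of-difference in y , trans (solve 2 (λ u c → u := (u :- c) :+ c) refl _ c) (trans (+-congʳ eq) (+-identityˡ c))
    where
    large : ∀ n → 0# < (1# + c) ^ suc n - c
    large zero    = pos-resp (solve 1 (λ c → con (+ 1) := (con (+ 1) :+ c) :* con (+ 1) :- c) refl c) 1-pos
    large (suc n) = pos-resp (solve 2 (λ c u → (u :- c) :+ c :* u := (con (+ 1) :+ c) :* u :- c) refl c ((1# + c) ^ suc n))
      (+-pos (large n) (*-pos 0<c (^-pos (suc n) (+-pos 1-pos 0<c))))
    zero-of-difference : ∃ λ y → y ^ suc n - c ≈ 0#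
    zero-of-difference = intermediate-value (smooth-minus (smooth-^ (suc n) smooth-id) (smooth-const c))
      (+-pos 1-pos 0<c)
      (pos-neg (pos-resp (solve 2 (λ c u → c := :- (con (+ 0) :* u :- c)) refl c (0# ^ n)) 0<c))
      (large n)

-- Removing real factors under a root, and reduction of the exponent.

module RealScalars (ℝ : CompleteOrderedField) (K : CharacteristicZeroField) where
  open RealAnalysis ℝ
  open CharacteristicZeroField K
  open FieldProperties K
  private
    module ℝ = CompleteOrderedField ℝ
    module R = CommutativeRing ℝ.commutativeRing
    module ℝ-exp = Algebra.Definitions.RawSemiring (Semiring.rawSemiring R.semiring)
    module < = IsStrictTotalOrder ℝ.isStrictTotalOrder

  module _ (ι : R.Carrier → Carrier) (ι-cong : ∀ {r s} → r R.≈ s → ι r ≈ ι s)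
           (ι-0 : ι R.0# ≈ 0#) (ι-1 : ι R.1# ≈ 1#)
           (ι-* : ∀ r s → ι (r R.* s) ≈ ι r * ι s) (ι-neg : ∀ r → ι (R.- r) ≈ - ι r) where

    ι-^ : ∀ r n → ι (r ℝ-exp.^ n) ≈ ι r ^ n
    ι-^ r zero    = ι-1
    ι-^ r (suc n) = trans (ι-* r _) (*-congˡ (ι-^ r n))

    ι-reciprocal : ∀ {r s} → r R.* s R.≈ R.1# → ι r * ι s ≈ 1#
    ι-reciprocal rs≈1 = trans (sym (ι-* _ _)) (trans (ι-cong rs≈1) ι-1)

    -- A positive `τ` is removed by a real root of its inverse, a negative one by a real root of the
    -- inverse of -τ times `ζ`; w ≠ 0 excludes τ = 0.
    rescale-root : ∀ n {ζ w τ z} → ζ ^ suc n ≈ - 1# → ¬ w ≈ 0# → w ^ suc n ≈ ι τ * z → ∃ λ v → v ^ suc n ≈ z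
    rescale-root n {ζ} {w} {τ} {z} ζⁿ≈-1 w≉0 wⁿ≈τz with <.compare τ R.0#
    ... | tri≈ _ τ≈0 _ = contradiction (trans wⁿ≈τz (trans (*-congʳ (trans (ι-cong τ≈0) ι-0)) (zeroˡ z))) (^-≉0 (suc n) w≉0)
    ... | tri> _ _ 0<τ = let (k , 0<k , kτ≈1) = reciprocal 0<τ ; (r , rⁿ≈k) = root-pos n 0<k in
      ι r * w , *-^-multiple (suc n) {k = ι k} (trans (sym (ι-^ r (suc n))) (ι-cong rⁿ≈k)) wⁿ≈τz (ι-reciprocal kτ≈1)
    ... | tri< τ<0 _ _ = let (k , 0<k , k[-τ]≈1) = reciprocal (neg-pos τ<0) ; (r , rⁿ≈k) = root-pos n 0<k in
      ζ * ι r * w , *-^-multiple (suc n) {k = - 1# * ι k}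
        (trans (^-distrib-* ζ (ι r) (suc n)) (*-cong ζⁿ≈-1 (trans (sym (ι-^ r (suc n))) (ι-cong rⁿ≈k)))) wⁿ≈τz
        (trans (-1*-assoc (ι k) (ι τ)) (trans (*-congˡ (sym (ι-neg τ))) (ι-reciprocal k[-τ]≈1)))

  parity : ∀ n → (∃ λ l → n ≡ 2 ℕ.* l) ⊎ (∃ λ l → n ≡ suc (2 ℕ.* l))
  parity zero    = inj₁ (0 , ≡.refl)
  parity (suc n) with parity n
  ... | inj₁ (l , ≡.refl) = inj₂ (l , ≡.refl)
  ... | inj₂ (l , ≡.refl) = inj₁ (suc l , ≡.cong suc (≡.sym (ℕₚ.+-suc l (l ℕ.+ 0))))

  -- Square roots halve an even exponent. Only the exponents 2 and odd are left, for which a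
  -- solution of ζⁿ = -1 is explicit: i and -1.
  roots : (∀ z → ¬ z ≈ 0# → ∃ λ w → w ^ 2 ≈ z) → (∀ l z → ¬ z ≈ 0# → ∃ λ w → w ^ suc (2 ℕ.* l) ≈ z) →
          ∀ n → 0 ℕ.< n → ∀ z → ¬ z ≈ 0# → ∃ λ w → w ^ n ≈ z
  roots square-root odd-root = <-rec _ step
    where
    step : ∀ n → (∀ {m} → m ℕ.< n → 0 ℕ.< m → ∀ z → ¬ z ≈ 0# → ∃ λ w → w ^ m ≈ z) →
           0 ℕ.< n → ∀ z → ¬ z ≈ 0# → ∃ λ w → w ^ n ≈ z
    step n rec 0<n z z≉0 with parity n
    ... | inj₂ (l , ≡.refl)     = odd-root l z z≉0
    ... | inj₁ (suc l , ≡.refl) =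
      let (v , v²≈z) = square-root z z≉0
          v≉0 : ¬ v ≈ 0#
          v≉0 v≈0 = z≉0 (trans (sym v²≈z) (trans (*-congʳ v≈0) (zeroˡ _)))
          (w , wˡ≈v) = rec (ℕₚ.m<m+n (suc l) {suc l ℕ.+ 0} (s≤s z≤n)) (s≤s z≤n) v v≉0
      in w , trans (^-congʳ w (ℕₚ.*-comm 2 (suc l))) (trans (sym (^-assocʳ w (suc l) 2)) (trans (^-congˡ 2 wˡ≈v) v²≈z))

-- Roots of nonzero complex numbers.

module ComplexRoots (ℝ : CompleteOrderedField) where
  open Complex ℝ using (ℂ; _+i_; re; im; ℂ-commutativeRing)
  open RealAnalysis ℝ
  private
    module ℝ = CompleteOrderedField ℝ
    module R = CommutativeRing ℝ.commutativeRing
    module ℝ-exp = Algebra.Definitions.RawSemiring (Semiring.rawSemiring R.semiring)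
    module < = IsStrictTotalOrder ℝ.isStrictTotalOrder

  complexField : CharacteristicZeroField
  complexField = record
    { commutativeRing = ℂ-commutativeRing
    ; _≟_     = λ z w → (re z <.≟ re w) ×-dec (im z <.≟ im w)
    ; inverse = λ {z} z≉0 → Complex.inverse ℝ z z≉0 , Complex.inverseʳ ℝ z z≉0
    ; char0   = λ n eq → pos≉0 (×1-pos n) (R.trans (R.sym (re-× (suc n))) (proj₁ eq))
    }
    where
    open Algebra.Definitions.RawSemiring (Semiring.rawSemiring (CommutativeRing.semiring ℂ-commutativeRing)) renaming (_×_ to _×ᶜ_)
    re-× : ∀ n → re (n ×ᶜ Complex.1ℂ ℝ) R.≈ n ℝ-exp.× R.1#
    re-× zero    = R.refl
    re-× (suc n) = R.+-congˡ (re-× n)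

  open CharacteristicZeroField complexField
  open FieldProperties complexField
  open RealScalars ℝ complexField
  open IntegerCoefficients ℝ.commutativeRing
    renaming (solve to solve′; _:*_ to _:*′_; _:=_ to _:=′_; _:-_ to _:-′_; _:+_ to _:+′_; con to con′; :-_ to :-′_)
  open Relation.Binary.Reasoning.Setoid setoid

  ι : R.Carrier → ℂ
  ι r = r +i R.0#

  ι-cong : ∀ {r s} → r R.≈ s → ι r ≈ ι s
  ι-cong r≈s = r≈s , R.refl

  ι-* : ∀ r s → ι (r R.* s) ≈ ι r * ι s
  ι-* r s = solve′ 2 (λ r s → r :*′ s :=′ r :*′ s :-′ con′ (+ 0) :*′ con′ (+ 0)) R.refl r s
          , solve′ 2 (λ r s → con′ (+ 0) :=′ r :*′ con′ (+ 0) :+′ con′ (+ 0) :*′ s) R.refl r s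

  ι-neg : ∀ r → ι (R.- r) ≈ - ι r
  ι-neg r = R.refl , solve′ 0 (con′ (+ 0) :=′ :-′ con′ (+ 0)) R.refl

  record SmoothPath (w : R.Carrier → ℂ) : Set where
    constructor path
    field
      real      : Smooth (λ t → re (w t))
      imaginary : Smooth (λ t → im (w t))
  open SmoothPath

  smoothPath-^ : ∀ {w} n → SmoothPath w → SmoothPath (λ t → w t ^ n)
  smoothPath-^ zero    p = path (smooth-const R.1#) (smooth-const R.0#)
  smoothPath-^ (suc n) p = let q = smoothPath-^ n p in path
    (smooth-minus (smooth-* (real p) (real q)) (smooth-* (imaginary p) (imaginary q)))
    (smooth-+ (smooth-* (real p) (imaginary q)) (smooth-* (imaginary p) (real q)))

  -- The factor is the coefficient of the orthogonal projection of `u` on `z`, the inner product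
  -- divided by the squared norm of `z`.
  collinear⇒multiple : ∀ {z u} → ¬ z ≈ 0# → re z R.* im u R.- im z R.* re u R.≈ R.0# → ∃ λ τ → u ≈ ι τ * z
  collinear⇒multiple {a +i b} {c +i d} z≉0 ad-bc≈0 = τ ,
    ( R.trans (R.sym (R.trans (R.*-congʳ kN≈1) (R.*-identityˡ c)))
        (R.trans (solve′ 5 (λ a b c d k → k :*′ (a :*′ a :+′ b :*′ b) :*′ c :=′
            ((a :*′ c :+′ b :*′ d) :*′ k :*′ a :-′ con′ (+ 0) :*′ b) :-′ k :*′ b :*′ (a :*′ d :-′ b :*′ c)) R.refl a b c d k)
          (drop (k R.* b)))
    , R.trans (R.sym (R.trans (R.*-congʳ kN≈1) (R.*-identityˡ d)))
        (R.trans (solve′ 5 (λ a b c d k → k :*′ (a :*′ a :+′ b :*′ b) :*′ d :=′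
            ((a :*′ c :+′ b :*′ d) :*′ k :*′ b :+′ con′ (+ 0) :*′ a) :-′ (:-′ (k :*′ a)) :*′ (a :*′ d :-′ b :*′ c)) R.refl a b c d k)
          (drop (R.- (k R.* a)))) )
    where
    drop : ∀ {x} y → x R.- y R.* (a R.* d R.- b R.* c) R.≈ x
    drop {x} y = R.trans (R.+-congˡ (R.-‿cong (R.*-congˡ ad-bc≈0))) (solve′ 2 (λ x y → x :-′ y :*′ con′ (+ 0) :=′ x) R.refl x y)
    norm-pos : R.0# ℝ.< a R.* a R.+ b R.* b
    norm-pos with a <.≟ R.0# | b <.≟ R.0#
    ... | no a≉0  | _       = +-pos-nonneg (square-pos a≉0) (square-nonneg b)
    ... | yes a≈0 | no b≉0  = pos-resp (R.+-comm _ _) (+-pos-nonneg (square-pos b≉0) (square-nonneg a))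
    ... | yes a≈0 | yes b≈0 = contradiction (a≈0 , b≈0) z≉0
    k = proj₁ (reciprocal norm-pos)
    kN≈1 = proj₂ (proj₂ (reciprocal norm-pos))
    τ = (a R.* c R.+ b R.* d) R.* k

  -- Along a path from a 2n-th root of unity ζ to 1, some w ^ n is a real multiple of z.
  root-via-path : ∀ n {ζ} → ζ ^ suc n ≈ - 1# → ∀ {y lo hi} → Smooth y → y R.0# R.≈ R.1# →
    lo ℝ.< hi → (lo +i y lo) ≈ ζ → (hi +i y hi) ≈ 1# → ∀ z → ¬ z ≈ 0# → ∃ λ w → w ^ suc n ≈ z
  root-via-path n {ζ} ζⁿ≈-1 {y} {lo} {hi} sy y0≈1 lo<hi wlo≈ζ whi≈1 z@(a +i b) z≉0 =
    rescale-root ι ι-cong refl refl ι-* ι-neg n ζⁿ≈-1 w≉0 (proj₂ multiple)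
    where
    w : R.Carrier → ℂ
    w t = t +i y t
    wⁿ : R.Carrier → ℂ
    wⁿ t = w t ^ suc n
    smooth-wⁿ : SmoothPath wⁿ
    smooth-wⁿ = smoothPath-^ (suc n) (path smooth-id sy)
    -- The determinant of `z` and wⁿ, which vanishes when they are collinear. At the ends wⁿ is -1
    -- and 1, giving the opposite values b and -b.
    f : R.Carrier → R.Carrier
    f t = a R.* im (wⁿ t) R.- b R.* re (wⁿ t)
    smooth-f : Smooth f
    smooth-f = smooth-minus (smooth-* (smooth-const a) (imaginary smooth-wⁿ)) (smooth-* (smooth-const b) (real smooth-wⁿ))
    f-at : ∀ {t u} → wⁿ t ≈ u → f t R.≈ a R.* im u R.- b R.* re u
    f-at (r , i) = R.+-cong (R.*-congˡ i) (R.-‿cong (R.*-congˡ r))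
    zero-f : ∃ λ s → f s R.≈ R.0#
    zero-f = antisymmetric-zero smooth-f {b = b} lo<hi
      (R.trans (f-at (trans (^-congˡ (suc n) wlo≈ζ) ζⁿ≈-1)) (solve′ 2 (λ a b → a :*′ (:-′ con′ (+ 0)) :-′ b :*′ (:-′ con′ (+ 1)) :=′ b) R.refl a b))
      (R.trans (f-at (trans (^-congˡ (suc n) whi≈1) (1^ (suc n)))) (solve′ 2 (λ a b → a :*′ con′ (+ 0) :-′ b :*′ con′ (+ 1) :=′ :-′ b) R.refl a b))
    s = proj₁ zero-f
    multiple = collinear⇒multiple {z} {wⁿ s} z≉0 (proj₂ zero-f)
    -- The path meets the imaginary axis only at parameter 0, where its height is 1.
    w≉0 : ¬ w s ≈ 0#
    w≉0 (s≈0 , ys≈0) = ℝ.0≉1 (R.trans (R.sym ys≈0) (R.trans (Smooth.congruent sy s≈0) y0≈1))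

  -- Here ζ = i, and the path is the segment from i to 1.
  square-root : ∀ z → ¬ z ≈ 0# → ∃ λ w → w ^ 2 ≈ z
  square-root = root-via-path 1 {R.0# +i R.1#}
    ( solve′ 0 (o :*′ (o :*′ e :-′ e :*′ o) :-′ e :*′ (o :*′ o :+′ e :*′ e) :=′ :-′ e) R.refl
    , solve′ 0 (o :*′ (o :*′ o :+′ e :*′ e) :+′ e :*′ (o :*′ e :-′ e :*′ o) :=′ :-′ o) R.refl )
    (smooth-minus (smooth-const R.1#) smooth-id)
    1-0≈1 1-pos (R.refl , 1-0≈1) (R.refl , R.-‿inverseʳ R.1#)
    where
    o e : ∀ {n} → Polynomial n
    o = con′ (+ 0)
    e = con′ (+ 1)
    1-0≈1 : R.1# R.- R.0# R.≈ R.1#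
    1-0≈1 = solve′ 0 (e :-′ o :=′ e) R.refl

  -- Here ζ = -1. The segment to 1 would pass through 0, so the path is the arc of the parabola y =
  -- 1 - t².
  odd-root : ∀ l z → ¬ z ≈ 0# → ∃ λ w → w ^ suc (2 ℕ.* l) ≈ z
  odd-root l = root-via-path (2 ℕ.* l) { - 1#} (-1^odd l)
    (smooth-minus (smooth-const R.1#) (smooth-* smooth-id smooth-id))
    (solve′ 0 (e :-′ o :*′ o :=′ e) R.refl)
    (pos-difference (pos-resp (solve′ 0 (e :+′ e :=′ e :-′ :-′ e) R.refl) (+-pos 1-pos 1-pos)))
    (R.refl , solve′ 0 (e :-′ (:-′ e) :*′ (:-′ e) :=′ :-′ o) R.refl)
    (R.refl , solve′ 0 (e :-′ e :*′ e :=′ o) R.refl)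
    where
    o e : ∀ {n} → Polynomial n
    o = con′ (+ 0)
    e = con′ (+ 1)

  root : ∀ n → 0 ℕ.< n → ∀ z → ¬ z ≈ 0# → ∃ λ w → w ^ n ≈ z
  root = roots square-root odd-root

open import Data.Nat.Base using (_∸_; _≤_; _<_)

-- Affine conjugation and the normal form.

module Conjugation (K : CharacteristicZeroField) where
  open CharacteristicZeroField K
  open FieldProperties K
  open PolynomialFunctions K
  open Evaluation K
  open Commuting K
  open IntegerCoefficients commutativeRing using (solve; _:=_; _:+_; _:*_; _:-_; :-_; con)
  open Polynomials commutativeRing
  open Relation.Binary.Reasoning.Setoid setoid

  module _ (s τ : Carrier) (s≉0 : ¬ s ≈ 0#) where

    private
      k : Carrier
      k = proj₁ (inverse s≉0)

    apply apply⁻¹ conjugate : ∀ {l} → Poly l → Poly l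
    apply p     = const s *ₚ p +ₚ const τ
    apply⁻¹ p   = const k *ₚ (p +ₚ const (- τ))
    conjugate p = apply (p ⟦ (λ i → apply⁻¹ (X i)) ⟧)

    to from : Carrier → Carrier
    to y   = s * y + τ
    from w = k * (w - τ)

    sk≈1 : s * k ≈ 1#
    sk≈1 = proj₂ (inverse s≉0)

    to-cong : ∀ {x y} → x ≈ y → to x ≈ to y
    to-cong x≈y = +-congʳ (*-congˡ x≈y)

    from-cong : ∀ {x y} → x ≈ y → from x ≈ from y
    from-cong x≈y = *-congˡ (+-congʳ x≈y)

    from-to : ∀ y → from (to y) ≈ y
    from-to y = begin
      k * (s * y + τ - τ)  ≈⟨ solve 4 (λ k s y t → k :* (s :* y :+ t :- t) := s :* k :* y) refl k s y τ ⟩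
      s * k * y            ≈⟨ *-congʳ sk≈1 ⟩
      1# * y               ≈⟨ *-identityˡ y ⟩
      y                    ∎

    eval-apply : ∀ {l} (p : Poly l) x → eval (apply p) x ≈ to (eval p x)
    eval-apply p x = trans (eval-+ (const s *ₚ p) (const τ) x)
      (+-cong (trans (eval-* (const s) p x) (*-congʳ (eval-const s x))) (eval-const τ x))

    eval-apply⁻¹ : ∀ {l} (p : Poly l) x → eval (apply⁻¹ p) x ≈ from (eval p x)
    eval-apply⁻¹ p x = trans (eval-* (const k) (p +ₚ const (- τ)) x)
      (*-cong (eval-const k x) (trans (eval-+ p (const (- τ)) x) (+-congˡ (eval-const (- τ) x))))

    eval-conjugate : ∀ {l} (p : Poly l) x → eval (conjugate p) x ≈ to (eval p (from ∘ x))
    eval-conjugate p x = trans (eval-apply (p ⟦ (λ i → apply⁻¹ (X i)) ⟧) x) (to-cong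
      (trans (eval-⟦⟧ p _ x) (eval-cong p λ i → trans (eval-apply⁻¹ (X i) x) (from-cong (eval-X i x)))))

    -- Conjugating `q` back by the inverse affine map gives the one-variable polynomial for `p`.
    conjugate-single : ∀ {l} (p : Poly l) i → InSingleVariable (conjugate p) i → InSingleVariable p i
    conjugate-single {l} p i (q , p̂≈q) = r , eval-injective {p = p} {r ∘ₚ X i} λ x → begin
      eval p x                                        ≈⟨ eval-cong p (λ j → from-to (x j)) ⟨
      eval p (from ∘ to ∘ x)                          ≈⟨ from-to _ ⟨
      from (to (eval p (from ∘ to ∘ x)))              ≈⟨ from-cong (eval-conjugate p (to ∘ x)) ⟨
      from (eval (conjugate p) (to ∘ x))              ≈⟨ from-cong (eval-resp {p = conjugate p} {q ∘ₚ X i} p̂≈q (to ∘ x)) ⟩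
      from (eval (q ∘ₚ X i) (to ∘ x))                 ≈⟨ from-cong (eval-⟦⟧ q (λ _ → X i) (to ∘ x)) ⟩
      from (eval q (λ _ → eval (X i) (to ∘ x)))       ≈⟨ from-cong (eval-cong q λ _ → head-variable x) ⟩
      from (eval q (λ _ → eval (apply X₀) (Xᵢ x)))    ≈⟨ from-cong (eval-⟦⟧ q (λ _ → apply X₀) (Xᵢ x)) ⟨
      from (eval (q ⟦ (λ _ → apply X₀) ⟧) (Xᵢ x))     ≈⟨ eval-apply⁻¹ (q ⟦ (λ _ → apply X₀) ⟧) (Xᵢ x) ⟨
      eval r (Xᵢ x)                                   ≈⟨ eval-⟦⟧ r (λ _ → X i) x ⟨
      eval (r ∘ₚ X i) x                               ∎
      where
      X₀ r : Poly 1
      X₀ = X zero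
      r  = apply⁻¹ (q ⟦ (λ _ → apply X₀) ⟧)
      Xᵢ : Point l → Point 1
      Xᵢ x _ = eval (X i) x
      head-variable : ∀ x → eval (X i) (to ∘ x) ≈ eval (apply X₀) (Xᵢ x)
      head-variable x = begin
        eval (X i) (to ∘ x)     ≈⟨ eval-X i (to ∘ x) ⟩
        to (x i)                ≈⟨ to-cong (eval-X i x) ⟨
        to (eval (X i) x)       ≈⟨ to-cong (eval-X zero (Xᵢ x)) ⟨
        to (eval X₀ (Xᵢ x))     ≈⟨ eval-apply X₀ (Xᵢ x) ⟨
        eval (apply X₀) (Xᵢ x)  ∎

    conjugated : Poly 1 → Carrier → Carrier
    conjugated P w = to (univariate P (from w))

    conjugated-cong : ∀ P {w v} → w ≈ v → conjugated P w ≈ conjugated P v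
    conjugated-cong P w≈v = to-cong (eval-cong P λ _ → from-cong w≈v)

    eval-conjugate-univariate : ∀ P x → eval (conjugate P) x ≈ conjugated P (x zero)
    eval-conjugate-univariate P x = trans (eval-conjugate P x) (to-cong (eval-cong P λ { zero → refl }))

    conjugate-commute : ∀ {l} (P : Poly 1) (Q : Poly l) → P ∘ₚ Q ≈ₚ Q ⟦ (λ i → P ∘ₚ X i) ⟧ →
      ∀ x → conjugated P (eval (conjugate Q) x) ≈ eval (conjugate Q) (conjugated P ∘ x)
    conjugate-commute P Q PQ≈QP x = begin
      to (univariate P (from (eval (conjugate Q) x)))    ≈⟨ to-cong (eval-cong P λ _ → trans (from-cong (eval-conjugate Q x)) (from-to _)) ⟩
      to (univariate P (eval Q (from ∘ x)))                ≈⟨ to-cong (eval-⟦⟧ P (λ _ → Q) (from ∘ x)) ⟨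
      to (eval (P ∘ₚ Q) (from ∘ x))                        ≈⟨ to-cong (eval-resp {p = P ∘ₚ Q} {Q ⟦ (λ i → P ∘ₚ X i) ⟧} PQ≈QP (from ∘ x)) ⟩
      to (eval (Q ⟦ (λ i → P ∘ₚ X i) ⟧) (from ∘ x))        ≈⟨ to-cong (trans (eval-⟦⟧ Q _ (from ∘ x)) (eval-cong Q λ i →
                                                                trans (eval-⟦⟧ P _ (from ∘ x)) (eval-cong P λ _ → eval-X i (from ∘ x)))) ⟩
      to (eval Q (λ i → univariate P (from (x i))))        ≈⟨ to-cong (eval-cong Q λ i → from-to _) ⟨
      to (eval Q (from ∘ conjugated P ∘ x))                ≈⟨ eval-conjugate Q (conjugated P ∘ x) ⟨
      eval (conjugate Q) (conjugated P ∘ x)              ∎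

    -- The two equations make the conjugate monic and remove its term of degree m + 1.
    conjugated-normal : ∀ {m a b} {f : Carrier → Carrier} → s ^ suc m ≈ a → (suc (suc m) ×ᴷ 1#) * (a * (k * τ)) ≈ b →
      Deg< (suc m) (λ t → f t - a * t ^ suc (suc m) - b * t ^ suc m) →
      Deg< (suc m) (λ w → to (f (from w)) - w ^ suc (suc m))
    conjugated-normal {m} {a} {b} {f} sᵐ≈a centred low = Deg<-cong
      (λ w → trans (+-congʳ (+-congʳ (+-congʳ (*-congˡ (+-congʳ (^-congˡ n (sym (from≈ w))))))))
        (trans (solve 8 (λ s a b u k v l τ → s :* a :* (u :- v) :+ s :* b :* k :+ s :* (l :- a :* u :- b :* k) :+ τ :=
                                    s :* l :+ τ :- s :* a :* v) refl s a b (from w ^ n) (from w ^ suc m) ((k * w) ^ n) (f (from w)) τ)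
          (+-congˡ (-‿cong (trans (*-congˡ (^-distrib-* k w n)) (trans (sym (*-assoc _ _ _)) (trans (*-congʳ sakⁿ≈1) (*-identityˡ _))))))))
      (Lead-0⇒Deg< sum coefficient≈0)
      where
      n = suc (suc m)
      from≈ : ∀ w → from w ≈ k * w + - (k * τ)
      from≈ w = solve 3 (λ k w t → k :* (w :- t) := k :* w :+ :- (k :* t)) refl k w τ
      Lead-kw : Lead 1 k (λ w → k * w)
      Lead-kw = Lead-cong refl (λ w → *-congˡ (*-identityʳ w)) (Lead-monomial 1 k)
      Lead-shift : Lead 0 (- (k * τ)) (λ _ → - (k * τ))
      Lead-shift = Lead-cong refl (λ w → *-identityʳ _) (Lead-monomial 0 _)
      Lead-from : Lead 1 k from
      Lead-from = Lead-cong refl (λ w → sym (from≈ w)) (Lead-+-Deg< Lead-kw (Lead⇒Deg< Lead-shift))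
      kᵐ = k ^ suc m
      -- As s a kⁿ = 1, wⁿ equals s a (k w)ⁿ, and the a-term leaves a difference of n-th powers of k
      -- w - k τ and k w. Its coefficient of degree m + 1 is the first summand; the b-term gives the
      -- second.
      c = s * a * (n ×ᴷ 1# * (kᵐ * - (k * τ))) + s * b * kᵐ
      sum : Lead (suc m) c _
      sum = Lead-+-Deg< (Lead-+-Deg< (Lead-+
        (Lead-scale (s * a) (Lead-≡ (≡.trans (ℕₚ.+-identityʳ _) (ℕₚ.*-identityʳ (suc m)))
          (Lead-power-difference (suc m) (s≤s z≤n) Lead-kw Lead-shift)))
        (Lead-scale (s * b) (Lead-≡ (ℕₚ.*-identityʳ (suc m)) (Lead-^ (suc m) Lead-from))))
        (Deg<-scale s (Deg<-≡ (≡.cong suc (ℕₚ.*-identityʳ m)) (Deg<-∘ low (Lead⇒Deg< Lead-from)))))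
        (Deg<-≤ (s≤s z≤n) (Deg<-const τ))
      coefficient≈0 : c ≈ 0#
      coefficient≈0 = trans
        (solve 6 (λ s a n K l b → s :* a :* (n :* (K :* :- l)) :+ s :* b :* K := s :* K :* (b :- n :* (a :* l))) refl s a (n ×ᴷ 1#) kᵐ (k * τ) b)
        (trans (*-congˡ (x≈y⇒x-y≈0 (sym centred))) (zeroʳ _))
      sakⁿ≈1 : s * a * k ^ n ≈ 1#
      sakⁿ≈1 = begin
        s * a * (k * kᵐ)           ≈⟨ solve 4 (λ s a k K → s :* a :* (k :* K) := s :* k :* (a :* K)) refl s a k kᵐ ⟩
        s * k * (a * kᵐ)           ≈⟨ *-cong sk≈1 (*-congʳ (sym sᵐ≈a)) ⟩
        1# * (s ^ suc m * kᵐ)      ≈⟨ *-identityˡ _ ⟩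
        s ^ suc m * kᵐ             ≈⟨ ^-distrib-* s k (suc m) ⟨
        (s * k) ^ suc m            ≈⟨ ^-congˡ (suc m) sk≈1 ⟩
        1# ^ suc m                 ≈⟨ 1^ (suc m) ⟩
        1#                         ∎

  -- Conjugation turns the leading coefficient a into s a s⁻ⁿ, so a slope with sⁿ⁻¹ = a makes it 1.
  normalising : (∀ n → 0 < n → ∀ z → ¬ z ≈ 0# → ∃ λ w → w ^ n ≈ z) → ∀ m (P : Poly 1) → HasDegree P (suc (suc m)) →
    ∃₂ λ s τ → ∃ λ s≉0 → Deg< (suc m) (λ w → conjugated s τ s≉0 P w - w ^ suc (suc m))
  normalising root m P ((j ∷ [] , j≡n , a≉0′) , vanish) = next (remainder (Lead-univariate n P λ l n<l →
      vanish (l ∷ []) (≡.subst (n <_) (≡.sym (ℕₚ.+-identityʳ l)) n<l)))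
    where
    n = suc (suc m)
    a = coeff P (n ∷ [])
    a≉0 : ¬ a ≈ 0#
    a≉0 = ≡.subst (λ l → ¬ coeff P (l ∷ []) ≈ 0#) (≡.trans (≡.sym (ℕₚ.+-identityʳ j)) j≡n) a≉0′
    s = proj₁ (root (suc m) (s≤s z≤n) a a≉0)
    sᵐ≈a : s ^ suc m ≈ a
    sᵐ≈a = proj₂ (root (suc m) (s≤s z≤n) a a≉0)
    s≉0 : ¬ s ≈ 0#
    s≉0 s≈0 = a≉0 (trans (sym sᵐ≈a) (trans (*-congʳ s≈0) (zeroˡ _)))
    k = proj₁ (inverse s≉0)
    na≉0 : ¬ (n ×ᴷ 1#) * a ≈ 0#
    na≉0 = *-≉0 (char0 (suc m)) a≉0
    v = proj₁ (inverse na≉0)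
    next : Deg< n (λ t → univariate P t - a * t ^ n) → _
    -- The intercept makes k τ equal to b / (n a), the shift that removes the term of degree n - 1.
    next (top b low) = s , s * (v * b) , s≉0 , conjugated-normal s (s * (v * b)) s≉0 {f = univariate P} sᵐ≈a (begin
      (n ×ᴷ 1#) * (a * (k * (s * (v * b))))
        ≈⟨ solve 6 (λ n a k s v b → n :* (a :* (k :* (s :* (v :* b)))) := s :* k :* (n :* a :* v) :* b) refl (n ×ᴷ 1#) a k s v b ⟩
      s * k * ((n ×ᴷ 1#) * a * v) * b
        ≈⟨ *-congʳ (*-cong (proj₂ (inverse s≉0)) (proj₂ (inverse na≉0))) ⟩
      1# * 1# * b
        ≈⟨ solve 1 (λ b → con (+ 1) :* con (+ 1) :* b := b) refl b ⟩
      b ∎) low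

  normal-form : (∀ n → 0 < n → ∀ z → ¬ z ≈ 0# → ∃ λ w → w ^ n ≈ z) →
    ∀ ν m (P : Poly 1) → HasDegree P (suc (suc m)) → (Q : Poly (suc ν)) →
    P ∘ₚ Q ≈ₚ Q ⟦ (λ i → P ∘ₚ X i) ⟧ → (∀ i → ¬ InSingleVariable Q i) →
    ∃₂ λ s τ → ∃ λ s≉0 → ∃₂ λ c α →
      α ≢ replicate (suc ν) 0 ×
      conjugate s τ s≉0 P ≈ₚ monomial 1# (suc (suc m) ∷ []) ×
      conjugate s τ s≉0 Q ≈ₚ monomial c α ×
      c ^ suc m ≈ 1#
  normal-form root ν m P P-degree Q PQ≈QP not-single =
    s , τ , s≉0 , c , α , α≢0 , P̂≈xⁿ , Q̂≈cxᵅ , cᵐ≈1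
    where
    n : ℕ
    n = suc (suc m)
    normalised = normalising root m P P-degree
    s τ : Carrier
    s = proj₁ normalised
    τ = proj₁ (proj₂ normalised)
    s≉0 : ¬ s ≈ 0#
    s≉0 = proj₁ (proj₂ (proj₂ normalised))
    P̂ : Carrier → Carrier
    P̂ = conjugated s τ s≉0 P
    low : Carrier → Carrier
    low w = P̂ w - w ^ n
    low-degree : Deg< (suc m) low
    low-degree = proj₂ (proj₂ (proj₂ normalised))
    P̂≈ : ∀ w → P̂ w ≈ w ^ n + low w
    P̂≈ w = solve 2 (λ p u → p := u :+ (p :- u)) refl (P̂ w) (w ^ n)
    Q̂ : Poly (suc ν)
    Q̂ = conjugate s τ s≉0 Q
    commute : ∀ x → P̂ (eval Q̂ x) ≈ eval Q̂ (P̂ ∘ x)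
    commute = conjugate-commute s τ s≉0 P Q PQ≈QP
    Q̂-not-single : ∀ i → ¬ InSingleVariable Q̂ i
    Q̂-not-single i single = not-single i (conjugate-single s τ s≉0 Q i single)
    low≈0 : ∀ w → low w ≈ 0#
    low≈0 = power-form m P̂ low (conjugated-cong s τ s≉0 P) P̂≈ low-degree Q̂ commute Q̂-not-single zero
    P̂-power : ∀ w → P̂ w ≈ w ^ n
    P̂-power w = x-y≈0⇒x≈y _ _ (low≈0 w)
    nonzero : ∃ λ α → ¬ coeff Q̂ α ≈ 0#
    nonzero with zero-or-coeff Q̂
    -- The zero polynomial is `[]` composed with a variable, hence in a single variable.
    ... | inj₁ Q̂≈0 = contradiction ([] , Q̂≈0) (Q̂-not-single zero)
    ... | inj₂ αc  = αc
    α : Vec ℕ (suc ν)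
    α = proj₁ nonzero
    c : Carrier
    c = coeff Q̂ α
    c≉0 : ¬ c ≈ 0#
    c≉0 = proj₂ nonzero
    P̂≈xⁿ : conjugate s τ s≉0 P ≈ₚ monomial 1# (n ∷ [])
    P̂≈xⁿ = eval-injective {p = conjugate s τ s≉0 P} {monomial 1# (n ∷ [])} λ x → begin
      eval (conjugate s τ s≉0 P) x             ≈⟨ eval-conjugate-univariate s τ s≉0 P x ⟩
      P̂ (x zero)                         ≈⟨ P̂-power (x zero) ⟩
      x zero ^ n                         ≈⟨ solve 1 (λ u → u := con (+ 1) :* (u :* con (+ 1)) :+ con (+ 0)) refl (x zero ^ n) ⟩
      eval (monomial 1# (n ∷ [])) x      ∎
    Q̂≈cxᵅ : Q̂ ≈ₚ monomial c α
    Q̂≈cxᵅ = monomial-form m P̂ low (conjugated-cong s τ s≉0 P) P̂≈ low-degree Q̂ commute Q̂-not-single zero c≉0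
    eval-Q̂ : ∀ x → eval Q̂ x ≈ c * mono x α
    eval-Q̂ x = trans (eval-resp {p = Q̂} {monomial c α} Q̂≈cxᵅ x) (eval-monomial c α x)
    α≢0 : α ≢ replicate (suc ν) 0
    α≢0 α≡0 = Q̂-not-single zero (const c , eval-injective {p = Q̂} {const c ∘ₚ X zero} λ x → begin
      eval Q̂ x                          ≈⟨ eval-Q̂ x ⟩
      c * mono x α                      ≡⟨ ≡.cong (λ β → c * mono x β) α≡0 ⟩
      c * mono x (replicate (suc ν) 0)  ≈⟨ trans (*-congˡ (mono-0 x)) (*-identityʳ c) ⟩
      c                                 ≈⟨ eval-const c (X₀ x) ⟨
      eval (const c) (X₀ x)             ≈⟨ eval-⟦⟧ (const {1} c) (λ _ → X zero) x ⟨
      eval (const c ∘ₚ X zero) x        ∎)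
      where
      X₀ : Point (suc ν) → Point 1
      X₀ x _ = eval (X zero) x
    mono-1 : ∀ {k} (β : Vec ℕ k) → mono (λ _ → 1#) β ≈ 1#
    mono-1 []      = refl
    mono-1 (b ∷ β) = trans (*-cong (1^ b) (mono-1 β)) (*-identityˡ 1#)
    Q̂-1 : eval Q̂ (λ _ → 1#) ≈ c
    Q̂-1 = trans (eval-Q̂ _) (trans (*-congˡ (mono-1 α)) (*-identityʳ c))
    -- At the point with all coordinates 1, fixed by the power map, commutation reads cⁿ = c.
    cᵐ≈1 : c ^ suc m ≈ 1#
    cᵐ≈1 = x-y≈0⇒x≈y _ _ (*-cancel-0 c≉0 (begin
      c * (c ^ suc m - 1#)         ≈⟨ solve 2 (λ c u → c :* (u :- con (+ 1)) := c :* u :- c) refl c (c ^ suc m) ⟩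
      c ^ n - c                    ≈⟨ x≈y⇒x-y≈0 (begin
        c ^ n                          ≈⟨ P̂-power c ⟨
        P̂ c                            ≈⟨ conjugated-cong s τ s≉0 P (sym Q̂-1) ⟩
        P̂ (eval Q̂ (λ _ → 1#))          ≈⟨ commute _ ⟩
        eval Q̂ (λ _ → P̂ 1#)            ≈⟨ eval-cong Q̂ (λ _ → trans (P̂-power 1#) (1^ n)) ⟩
        eval Q̂ (λ _ → 1#)              ≈⟨ Q̂-1 ⟩
        c                              ∎) ⟩
      0#                           ∎))

theorem1p2 : (ℝ : CompleteOrderedField) →
    let open ComplexPolynomials ℝ in
    (ν : ℕ) → 2 ≤ ν →
    (P : Poly 1) (n : ℕ) → HasDegree P n → 1 < n →
    (Q : Poly ν) (d : ℕ) → HasDegree Q d → 1 ≤ d →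
    P ∘ₚ Q ≈ₚ Q ⟦ (λ i → P ∘ₚ X i) ⟧ →
    (∀ (i : Fin ν) → ¬ InSingleVariable Q i) →
    Σ Aff λ φ → Σ ℂ λ c → Σ (Vec ℕ ν) λ α →
    α ≢ replicate ν 0 ×
    conjugate φ P ≈ₚ monomial 1ℂ (n ∷ []) ×
    conjugate φ Q ≈ₚ monomial c α ×
    c ^ℂ (n ∸ 1) ≈ℂ 1ℂ
theorem1p2 ℝ (suc ν) _ P (suc (suc m)) P-degree (s≤s (s≤s z≤n)) Q _ _ _ PQ≈QP not-single =
  let (s , τ , s≉0 , c , α , result) = Conjugation.normal-form complexField root ν m P P-degree Q PQ≈QP not-single
  in record { slope = s ; intercept = τ ; slope≉0 = s≉0 } , c , α , result
  where open ComplexRoots ℝ using (complexField; root)
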